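{- For every integer $k\geq 2$, the second largest element of $H(\infty,k)$ equals $2^k-2^{k-2}$ (the largest being $2^k$). Moreover, $2^k-2^{k-2}\in H(n,k)$ for all integers $n>k$.
   Context: Let $\mathbb{H}^n:=\{0,1\}^n\subset\mathbb{R}^n$. For integers $n\geq k\geq 1$, $H(n,k)$ denotes the set of non-zero cardinalities of intersections of $\mathbb{H}^n$ with $k$-dimensional affine subspaces of $\mathbb{R}^n$: $H(n,k)=\{t>0:\exists\, S\subset\mathbb{R}^n \text{ affine subspace},\ \dim S=k,\ t=|\mathbb{H}^n\cap S|\}$. Equivalently (by the symmetries of the hypercube), with $m=n-k$, $H(n,k)=\{t:\exists\, L:\mathbb{R}^k\to\mathbb{R}^m \text{ linear},\ t=|\mathbb{H}^k\cap L^{ -1}(\mathbb{H}^m)|\}$. Finally, $H(\infty,k):=\bigcup_{n\geq k}H(n,k)$. -}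

module Defs where

open import Level using (0ℓ) renaming (suc to ℓsuc)
open import Data.Nat.Base as ℕ using (ℕ)
import Data.Nat.Properties as ℕ
open import Data.Fin.Base using (Fin)
open import Data.Product using (Σ; ∃-syntax; _×_; _,_; proj₁; proj₂)
open import Data.Sum.Base using (_⊎_)
open import Data.Rational.Base as ℚ using (ℚ; 0ℚ; 1ℚ; ½; ∣_∣)
import Data.Rational.Properties as ℚ
import Data.Rational.Solver as ℚSolver
open import Data.Vec.Functional using (Vector; map; zipWith; replicate)
import Data.Vec.Functional.Relation.Binary.Equality.Setoid as VecEquality
open import Algebra.Bundles using (CommutativeRing)
open import Algebra.Structures using (IsCommutativeRing)
import Algebra.Definitions.RawMonoid as RawMonoidOps
open import Function.Bundles using (Bijection)
open import Relation.Unary using (Pred; _∩_; _∈_; _∖_; ｛_｝)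
open import Relation.Binary.Structures using (IsEquivalence)
import Relation.Binary.Construct.On as On
open import Relation.Binary.PropositionalEquality
  using (_≡_; refl; sym; trans; cong; subst; setoid)

-- The real numbers as Cauchy sequences of rationals. Two sequences name the same
-- real when their difference tends to 0, so _≈_ (not _≡_) is equality on ℝ.

IsCauchy : (ℕ → ℚ) → Set
IsCauchy s = ∀ ε → 0ℚ ℚ.< ε →
  ∃[ N ] (∀ m n → N ℕ.≤ m → N ℕ.≤ n → ∣ s m ℚ.- s n ∣ ℚ.< ε)

record ℝ : Set where
  constructor mkℝ
  field
    seq    : ℕ → ℚ
    cauchy : IsCauchy seq

open ℝ public

infix 4 _≈_

record _≈_ (x y : ℝ) : Set where
  constructor mk≈
  field
    close : ∀ ε → 0ℚ ℚ.< ε →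
      ∃[ N ] (∀ n → N ℕ.≤ n → ∣ seq x n ℚ.- seq y n ∣ ℚ.< ε)

open _≈_ public

private
  open ℚSolver.+-*-Solver

  half>0 : ∀ {ε} → 0ℚ ℚ.< ε → 0ℚ ℚ.< ½ ℚ.* ε
  half>0 {ε} 0<ε =
    ℚ.positive⁻¹ (½ ℚ.* ε) {{ℚ.pos*pos⇒pos ½ ε {{ℚ.positive 0<ε}}}}

  half+half : ∀ ε → ½ ℚ.* ε ℚ.+ ½ ℚ.* ε ≡ ε
  half+half ε = trans (sym (ℚ.*-distribʳ-+ ε ½ ½)) (ℚ.*-identityˡ ε)

  abstract
    -- share ε B is ε / (2 B).
    share : ℚ → (B : ℚ) → 0ℚ ℚ.< B → ℚ
    share ε B 0<B = (½ ℚ.* ε) ℚ.* (ℚ.1/ B) {{ℚ.pos⇒nonZero B {{ℚ.positive 0<B}}}}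

    share>0 : ∀ {ε} B (0<B : 0ℚ ℚ.< B) → 0ℚ ℚ.< ε → 0ℚ ℚ.< share ε B 0<B
    share>0 {ε} B 0<B 0<ε =
      ℚ.positive⁻¹ (share ε B 0<B)
        {{ℚ.pos*pos⇒pos (½ ℚ.* ε) {{ℚ.positive (half>0 0<ε)}}
          ((ℚ.1/ B) {{ℚ.pos⇒nonZero B {{ℚ.positive 0<B}}}})
          {{ℚ.1/pos⇒pos B {{ℚ.positive 0<B}}}}}}

    share-* : ∀ ε B (0<B : 0ℚ ℚ.< B) → share ε B 0<B ℚ.* B ≡ ½ ℚ.* ε
    share-* ε B 0<B =
      trans (ℚ.*-assoc (½ ℚ.* ε) _ B)
        (trans (cong ((½ ℚ.* ε) ℚ.*_)
                 (ℚ.*-inverseˡ B {{ℚ.pos⇒nonZero B {{ℚ.positive 0<B}}}}))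
               (ℚ.*-identityʳ (½ ℚ.* ε)))

  dist-sym : ∀ p q → ∣ p ℚ.- q ∣ ≡ ∣ q ℚ.- p ∣
  dist-sym p q =
    trans (cong ∣_∣ (solve 2 (λ a b → a :- b := :- (b :- a)) refl p q))
          (ℚ.∣-p∣≡∣p∣ (q ℚ.- p))

  sum-close : ∀ a b {ε} → ∣ a ∣ ℚ.< ½ ℚ.* ε → ∣ b ∣ ℚ.< ½ ℚ.* ε →
              ∣ a ℚ.+ b ∣ ℚ.< ε
  sum-close a b {ε} a< b< =
    ℚ.≤-<-trans (ℚ.∣p+q∣≤∣p∣+∣q∣ a b)
      (subst (∣ a ∣ ℚ.+ ∣ b ∣ ℚ.<_) (half+half ε) (ℚ.+-mono-< a< b<))

  *-mono-abs : ∀ a b {B δ} → 0ℚ ℚ.< δ → ∣ a ∣ ℚ.< B → ∣ b ∣ ℚ.< δ →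
               ∣ a ℚ.* b ∣ ℚ.< δ ℚ.* B
  *-mono-abs a b {B} {δ} 0<δ a< b< =
    subst (ℚ._< δ ℚ.* B) (sym (ℚ.∣p*q∣≡∣p∣*∣q∣ a b))
      (ℚ.≤-<-trans
        (ℚ.*-monoˡ-≤-nonNeg ∣ a ∣ {{ℚ.∣-∣-nonNeg a}} (ℚ.<⇒≤ b<))
        (subst (ℚ._< δ ℚ.* B) (ℚ.*-comm δ ∣ a ∣)
          (ℚ.*-monoʳ-<-pos δ {{ℚ.positive 0<δ}} a<)))

  product-close : ∀ a b c d {B C ε} (0<B : 0ℚ ℚ.< B) (0<C : 0ℚ ℚ.< C) →
    0ℚ ℚ.< ε → ∣ a ∣ ℚ.< B → ∣ d ∣ ℚ.< C →
    ∣ a ℚ.- c ∣ ℚ.< share ε C 0<C → ∣ b ℚ.- d ∣ ℚ.< share ε B 0<B →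
    ∣ a ℚ.* b ℚ.- c ℚ.* d ∣ ℚ.< ε
  product-close a b c d {B} {C} {ε} 0<B 0<C 0<ε a< d< ac bd =
    subst (λ z → ∣ z ∣ ℚ.< ε)
      (solve 4 (λ a b c d → a :* (b :- d) :+ d :* (a :- c) := a :* b :- c :* d)
        refl a b c d)
      (sum-close (a ℚ.* (b ℚ.- d)) (d ℚ.* (a ℚ.- c))
        (subst (∣ a ℚ.* (b ℚ.- d) ∣ ℚ.<_) (share-* ε B 0<B)
          (*-mono-abs a (b ℚ.- d) (share>0 B 0<B 0<ε) a< bd))
        (subst (∣ d ℚ.* (a ℚ.- c) ∣ ℚ.<_) (share-* ε C 0<C)
          (*-mono-abs d (a ℚ.- c) (share>0 C 0<C 0<ε) d< ac)))

  0<1 : 0ℚ ℚ.< 1ℚ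
  0<1 = ℚ.positive⁻¹ 1ℚ

  abstract
    bounded : ∀ {s} → IsCauchy s →
      ∃[ B ] (0ℚ ℚ.< B × ∃[ N ] (∀ n → N ℕ.≤ n → ∣ s n ∣ ℚ.< B))
    bounded {s} c =
      let N , p = c 1ℚ 0<1
      in  1ℚ ℚ.+ ∣ s N ∣
        , ℚ.<-≤-trans 0<1
            (subst (ℚ._≤ 1ℚ ℚ.+ ∣ s N ∣) (ℚ.+-identityʳ 1ℚ)
              (ℚ.+-monoʳ-≤ 1ℚ (ℚ.0≤∣p∣ (s N))))
        , N , λ n N≤n →
            subst (λ z → ∣ z ∣ ℚ.< 1ℚ ℚ.+ ∣ s N ∣)
              (solve 2 (λ a b → (a :- b) :+ b := a) refl (s n) (s N))
              (ℚ.≤-<-trans (ℚ.∣p+q∣≤∣p∣+∣q∣ (s n ℚ.- s N) (s N))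
                (ℚ.+-monoˡ-< ∣ s N ∣ (p n N N≤n ℕ.≤-refl)))

  ⊔₁ : ∀ {m n o} → m ℕ.⊔ n ℕ.≤ o → m ℕ.≤ o
  ⊔₁ {m} {n} = ℕ.m⊔n≤o⇒m≤o m n

  ⊔₂ : ∀ {m n o} → m ℕ.⊔ n ℕ.≤ o → n ℕ.≤ o
  ⊔₂ {m} {n} = ℕ.m⊔n≤o⇒n≤o m n

  regroup : ∀ a b c d → (a ℚ.- c) ℚ.+ (b ℚ.- d) ≡ (a ℚ.+ b) ℚ.- (c ℚ.+ d)
  regroup = solve 4 (λ a b c d → (a :- c) :+ (b :- d) := (a :+ b) :- (c :+ d)) refl

  zero-dist : ∀ {p q ε} → p ≡ q → 0ℚ ℚ.< ε → ∣ p ℚ.- q ∣ ℚ.< ε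
  zero-dist {p} {ε = ε} refl 0<ε =
    subst (λ z → ∣ z ∣ ℚ.< ε) (sym (ℚ.+-inverseʳ p)) 0<ε

infixl 6 _+_ _-_
infixl 7 _*_
infix  8 -_

fromℚ : ℚ → ℝ
fromℚ q = mkℝ (λ _ → q) (λ ε 0<ε → 0 , λ _ _ _ _ → zero-dist {q} refl 0<ε)

0ℝ 1ℝ : ℝ
0ℝ = fromℚ 0ℚ
1ℝ = fromℚ 1ℚ

private abstract
  cauchy-+ : ∀ x y → IsCauchy (λ n → seq x n ℚ.+ seq y n)
  cauchy-+ (mkℝ s cs) (mkℝ t ct) ε 0<ε =
    let M , p = cs _ (half>0 0<ε)
        N , q = ct _ (half>0 0<ε)
    in  M ℕ.⊔ N , λ m n m≥ n≥ →
        subst (λ z → ∣ z ∣ ℚ.< ε) (regroup (s m) (t m) (s n) (t n))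
          (sum-close (s m ℚ.- s n) (t m ℚ.- t n)
            (p m n (⊔₁ m≥) (⊔₁ n≥)) (q m n (⊔₂ {M} m≥) (⊔₂ {M} n≥)))

  cauchy-neg : ∀ x → IsCauchy (λ n → ℚ.- seq x n)
  cauchy-neg (mkℝ s cs) ε 0<ε =
    let N , p = cs ε 0<ε
    in  N , λ m n m≥ n≥ →
        subst (λ z → ∣ z ∣ ℚ.< ε)
          (solve 2 (λ a b → b :- a := (:- a) :- (:- b)) refl (s m) (s n))
          (p n m n≥ m≥)

  cauchy-* : ∀ x y → IsCauchy (λ n → seq x n ℚ.* seq y n)
  cauchy-* (mkℝ s cs) (mkℝ t ct) ε 0<ε =
    let B , 0<B , K , bs = bounded cs
        C , 0<C , L , bt = bounded ct
        M , p = cs (share ε C 0<C) (share>0 C 0<C 0<ε)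
        N , q = ct (share ε B 0<B) (share>0 B 0<B 0<ε)
    in  (K ℕ.⊔ L) ℕ.⊔ (M ℕ.⊔ N) , λ m n m≥ n≥ →
        product-close (s m) (t m) (s n) (t n) 0<B 0<C 0<ε
          (bs m (⊔₁ {K} (⊔₁ m≥)))
          (bt n (⊔₂ {K} (⊔₁ n≥)))
          (p m n (⊔₁ {M} (⊔₂ {K ℕ.⊔ L} m≥)) (⊔₁ {M} (⊔₂ {K ℕ.⊔ L} n≥)))
          (q m n (⊔₂ {M} (⊔₂ {K ℕ.⊔ L} m≥)) (⊔₂ {M} (⊔₂ {K ℕ.⊔ L} n≥)))

_+_ : ℝ → ℝ → ℝ
seq    (x + y) n = seq x n ℚ.+ seq y n
cauchy (x + y)   = cauchy-+ x y

-_ : ℝ → ℝ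
seq    (- x) n = ℚ.- seq x n
cauchy (- x)   = cauchy-neg x

_-_ : ℝ → ℝ → ℝ
x - y = x + (- y)

_*_ : ℝ → ℝ → ℝ
seq    (x * y) n = seq x n ℚ.* seq y n
cauchy (x * y)   = cauchy-* x y

pointwise⇒≈ : ∀ {x y} → (∀ n → seq x n ≡ seq y n) → x ≈ y
pointwise⇒≈ e = mk≈ λ ε 0<ε → 0 , λ n _ → zero-dist (e n) 0<ε

≈-isEquivalence : IsEquivalence _≈_
≈-isEquivalence = record
  { refl  = pointwise⇒≈ (λ _ → refl)
  ; sym   = λ {x} {y} x≈y → mk≈ λ ε 0<ε →
      let N , p = close x≈y ε 0<ε
      in  N , λ n n≥ → subst (ℚ._< ε) (dist-sym (seq x n) (seq y n)) (p n n≥)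
  ; trans = λ {x} {y} {z} x≈y y≈z → mk≈ λ ε 0<ε →
      let M , p = close x≈y _ (half>0 0<ε)
          N , q = close y≈z _ (half>0 0<ε)
      in  M ℕ.⊔ N , λ n n≥ →
          subst (λ w → ∣ w ∣ ℚ.< ε)
            (solve 3 (λ a b c → (a :- b) :+ (b :- c) := a :- c) refl
              (seq x n) (seq y n) (seq z n))
            (sum-close (seq x n ℚ.- seq y n) (seq y n ℚ.- seq z n)
              (p n (⊔₁ n≥)) (q n (⊔₂ {M} n≥)))
  }

+-cong : ∀ {x x′ y y′} → x ≈ x′ → y ≈ y′ → x + y ≈ x′ + y′
+-cong {x} {x′} {y} {y′} x≈ y≈ = mk≈ λ ε 0<ε →
  let M , p = close x≈ _ (half>0 0<ε)
      N , q = close y≈ _ (half>0 0<ε)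
  in  M ℕ.⊔ N , λ n n≥ →
      subst (λ w → ∣ w ∣ ℚ.< ε)
        (regroup (seq x n) (seq y n) (seq x′ n) (seq y′ n))
        (sum-close (seq x n ℚ.- seq x′ n) (seq y n ℚ.- seq y′ n)
          (p n (⊔₁ n≥)) (q n (⊔₂ {M} n≥)))

-‿cong : ∀ {x y} → x ≈ y → - x ≈ - y
-‿cong {x} {y} x≈y = mk≈ λ ε 0<ε →
  let N , p = close x≈y ε 0<ε
  in  N , λ n n≥ →
      subst (ℚ._< ε)
        (trans (dist-sym (seq x n) (seq y n))
          (cong ∣_∣ (solve 2 (λ a b → b :- a := (:- a) :- (:- b)) refl
            (seq x n) (seq y n))))
        (p n n≥)

*-cong : ∀ {x x′ y y′} → x ≈ x′ → y ≈ y′ → x * y ≈ x′ * y′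
*-cong {x} {x′} {y} {y′} x≈ y≈ = mk≈ λ ε 0<ε →
  let B , 0<B , K , bx = bounded (cauchy x)
      C , 0<C , L , by = bounded (cauchy y′)
      M , p = close x≈ _ (share>0 C 0<C 0<ε)
      N , q = close y≈ _ (share>0 B 0<B 0<ε)
  in  (K ℕ.⊔ L) ℕ.⊔ (M ℕ.⊔ N) , λ n n≥ →
      product-close (seq x n) (seq y n) (seq x′ n) (seq y′ n) 0<B 0<C 0<ε
        (bx n (⊔₁ {K} (⊔₁ n≥)))
        (by n (⊔₂ {K} (⊔₁ n≥)))
        (p n (⊔₁ {M} (⊔₂ {K ℕ.⊔ L} n≥)))
        (q n (⊔₂ {M} (⊔₂ {K ℕ.⊔ L} n≥)))

ℝ-isCommutativeRing : IsCommutativeRing _≈_ _+_ _*_ -_ 0ℝ 1ℝ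
ℝ-isCommutativeRing = record
  { isRing = record
    { +-isAbelianGroup = record
      { isGroup = record
        { isMonoid = record
          { isSemigroup = record
            { isMagma = record { isEquivalence = ≈-isEquivalence ; ∙-cong = +-cong }
            ; assoc = λ x y z → pointwise⇒≈ λ n → ℚ.+-assoc (seq x n) (seq y n) (seq z n)
            }
          ; identity = (λ x → pointwise⇒≈ λ n → ℚ.+-identityˡ (seq x n))
                     , (λ x → pointwise⇒≈ λ n → ℚ.+-identityʳ (seq x n))
          }
        ; inverse = (λ x → pointwise⇒≈ λ n → ℚ.+-inverseˡ (seq x n))
                  , (λ x → pointwise⇒≈ λ n → ℚ.+-inverseʳ (seq x n))
        ; ⁻¹-cong = -‿cong
        }
      ; comm = λ x y → pointwise⇒≈ λ n → ℚ.+-comm (seq x n) (seq y n)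
      }
    ; *-cong = *-cong
    ; *-assoc = λ x y z → pointwise⇒≈ λ n → ℚ.*-assoc (seq x n) (seq y n) (seq z n)
    ; *-identity = (λ x → pointwise⇒≈ λ n → ℚ.*-identityˡ (seq x n))
                 , (λ x → pointwise⇒≈ λ n → ℚ.*-identityʳ (seq x n))
    ; distrib = (λ x y z → pointwise⇒≈ λ n → ℚ.*-distribˡ-+ (seq x n) (seq y n) (seq z n))
              , (λ x y z → pointwise⇒≈ λ n → ℚ.*-distribʳ-+ (seq x n) (seq y n) (seq z n))
    }
  ; *-comm = λ x y → pointwise⇒≈ λ n → ℚ.*-comm (seq x n) (seq y n)
  }

ℝ-commutativeRing : CommutativeRing 0ℓ 0ℓ
ℝ-commutativeRing = record { isCommutativeRing = ℝ-isCommutativeRing }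

open RawMonoidOps (CommutativeRing.+-rawMonoid ℝ-commutativeRing) public using (sum)

ℝ^_ : ℕ → Set
ℝ^ n = Vector ℝ n

open VecEquality (CommutativeRing.setoid ℝ-commutativeRing) public
  using (_≋_; ≋-setoid)

infixl 6 _+ᵥ_ _-ᵥ_
infixl 7 _*ᵥ_

0ᵥ : ∀ {n} → ℝ^ n
0ᵥ {n} = replicate n 0ℝ

_+ᵥ_ _-ᵥ_ : ∀ {n} → ℝ^ n → ℝ^ n → ℝ^ n
_+ᵥ_ = zipWith _+_
_-ᵥ_ = zipWith _-_

_*ᵥ_ : ∀ {n} → ℝ → ℝ^ n → ℝ^ n
a *ᵥ v = map (a *_) v

linearCombination : ∀ {n k} → ℝ^ k → Vector (ℝ^ n) k → ℝ^ n
linearCombination c b i = sum (λ j → c j * b j i)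

record LinearSubspace (n : ℕ) : Set₁ where
  field
    Member   : Pred (ℝ^ n) 0ℓ
    resp-≋   : ∀ {u v} → u ≋ v → Member u → Member v
    0-closed : Member 0ᵥ
    +-closed : ∀ {u v} → Member u → Member v → Member (u +ᵥ v)
    *-closed : ∀ a {v} → Member v → Member (a *ᵥ v)

record HasDimension {n : ℕ} (V : LinearSubspace n) (k : ℕ) : Set where
  open LinearSubspace V
  field
    basis       : Vector (ℝ^ n) k
    basis∈V     : ∀ j → Member (basis j)
    independent : ∀ c → linearCombination c basis ≋ 0ᵥ → c ≋ 0ᵥ
    spanning    : ∀ {v} → Member v → ∃[ c ] v ≋ linearCombination c basis

-- The translate base + direction.
record AffineSubspace (n : ℕ) : Set₁ where
  field
    base      : ℝ^ n
    direction : LinearSubspace n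

  Point : Pred (ℝ^ n) 0ℓ
  Point x = LinearSubspace.Member direction (x -ᵥ base)

AffineDimension : ∀ {n} → AffineSubspace n → ℕ → Set
AffineDimension S k = HasDimension (AffineSubspace.direction S) k

Hypercube : ∀ n → Pred (ℝ^ n) 0ℓ
Hypercube n x = ∀ i → x i ≈ 0ℝ ⊎ x i ≈ 1ℝ

-- |A| = t, where points are counted up to _≋_.
HasCardinality : ∀ {n} → Pred (ℝ^ n) 0ℓ → ℕ → Set
HasCardinality {n} A t =
  Bijection (setoid (Fin t)) (On.setoid {B = Σ (ℝ^ n) A} (≋-setoid n) proj₁)

H : ℕ → ℕ → Pred ℕ (ℓsuc 0ℓ)
H n k t = 0 ℕ.< t ×
  ∃[ S ] (AffineDimension {n} S k × HasCardinality (Hypercube n ∩ AffineSubspace.Point S) t)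

H∞ : ℕ → Pred ℕ (ℓsuc 0ℓ)
H∞ k t = ∃[ n ] (k ℕ.≤ n × t ∈ H n k)

IsLargest : ∀ {ℓ} → Pred ℕ ℓ → ℕ → Set ℓ
IsLargest A m = m ∈ A × (∀ t → t ∈ A → t ℕ.≤ m)

IsSecondLargest : ∀ {ℓ} → Pred ℕ ℓ → ℕ → Set ℓ
IsSecondLargest A s = ∃[ m ] (IsLargest A m × IsLargest (A ∖ ｛ m ｝) s)

{-# OPTIONS --safe #-}

-- Reduced echelon form turns S into the graph of an affine map over k of the coordinates, so
-- the points of S in the cube correspond to the y in {0,1}^k at which all n coordinates
-- f(y) = v + Σ aⱼ yⱼ of that map take values in {0,1}. If every coordinate does so for every y,
-- there are 2^k points. Otherwise fix an f that fails somewhere: if two of its coefficients are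
-- nonzero, then on each square in those two directions f has values v, w, x, z with v ≠ w, v ≠ x
-- and v + z = w + x, which are never all in {0,1}, so f is a bit at most 3/4 of the time; if
-- exactly one is nonzero, f takes two values, each half of the time, and one of them is no bit;
-- if none is, f is never a bit.
-- The value 3/4 is attained by f = y₁ + y₂.
--
-- Equality of reals is undecidable, but the resulting alternative between cardinalities is
-- decidable, so the finitely many case distinctions on reals can be made under ¬ ¬.

module Submission where

open import Defs
open import Data.Nat.Base using (ℕ; _≤_; _<_; _∸_; _^_)
open import Data.Product using (_×_)
open import Relation.Unary using (_∈_)
open import Level using (0ℓ)
open import Algebra.Bundles using (CommutativeRing)
import Algebra.Properties.CommutativeSemigroup as CommutativeSemigroupProperties
import Algebra.Properties.Group as GroupProperties
open import Data.Bool.Base using (Bool; true; false; if_then_else_)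
open import Data.Fin.Base using (Fin; zero; suc; _↑ˡ_; _↑ʳ_; splitAt)
import Data.Fin.Properties as Fin
open import Data.Nat.Base as ℕ using (zero; suc; z≤n)
import Data.Nat.Properties as ℕ
open import Data.Nat.Solver using () renaming (module +-*-Solver to ℕSolver)
open import Data.Product using (∃-syntax; _,_; proj₁; proj₂; map)
open import Data.Rational.Base as ℚ using (ℚ; 0ℚ; 1ℚ; ½; ∣_∣)
import Data.Rational.Properties as ℚ
open import Data.Rational.Solver using () renaming (module +-*-Solver to ℚSolver)
open import Data.Sum.Base using (_⊎_; inj₁; inj₂; [_,_]′; map₂)
open import Data.Vec.Base using (Vec; []; _∷_)
import Data.Vec.Properties as Vec
open import Data.Vec.Functional as Vector using (Vector; head; tail)
open import Effect.Monad using (RawMonad)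
open import Function.Base using (_∘_; id; const)
open import Function.Bundles using (Bijection)
open import Relation.Nullary using (¬_; Dec; does; yes; no; contradiction)
open import Relation.Nullary.Decidable using (decidable-stable; _⊎-dec_; ¬¬-excluded-middle)
open import Relation.Nullary.Negation using (¬¬-Monad)
open import Relation.Unary using (Pred; Decidable; _∩_)
open import Relation.Binary.PropositionalEquality
  using (_≡_; _≢_; refl; sym; trans; cong; cong₂; subst)

private
  module R = CommutativeRing ℝ-commutativeRing
import Relation.Binary.Reasoning.Setoid (CommutativeRing.setoid ℝ-commutativeRing) as ≈-Reasoning

-- Arithmetic of natural numbers.

open CommutativeSemigroupProperties ℕ.+-commutativeSemigroup using (interchange)

module _ where
  open ℕSolver

  interchange₂ : ∀ a a′ b b′ c c′ d d′ →
    ((a ℕ.+ a′) ℕ.+ (b ℕ.+ b′)) ℕ.+ ((c ℕ.+ c′) ℕ.+ (d ℕ.+ d′)) ≡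
    ((a ℕ.+ b) ℕ.+ (c ℕ.+ d)) ℕ.+ ((a′ ℕ.+ b′) ℕ.+ (c′ ℕ.+ d′))
  interchange₂ = solve 8 (λ a a′ b b′ c c′ d d′ →
    ((a :+ a′) :+ (b :+ b′)) :+ ((c :+ c′) :+ (d :+ d′)) :=
    ((a :+ b) :+ (c :+ d)) :+ ((a′ :+ b′) :+ (c′ :+ d′))) refl

  3*p+3*p : ∀ p → 3 ℕ.* p ℕ.+ 3 ℕ.* p ≡ 3 ℕ.* (2 ℕ.* p)
  3*p+3*p = solve 1 (λ p → con 3 :* p :+ con 3 :* p := con 3 :* (con 2 :* p)) refl

  4*3*p : ∀ p → 4 ℕ.* (3 ℕ.* p) ≡ 3 ℕ.* (2 ℕ.* (2 ℕ.* p))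
  4*3*p = solve 1 (λ p → con 4 :* (con 3 :* p) := con 3 :* (con 2 :* (con 2 :* p))) refl

  4*p : ∀ p → 2 ℕ.* (2 ℕ.* p) ≡ 3 ℕ.* p ℕ.+ p
  4*p = solve 1 (λ p → con 2 :* (con 2 :* p) := con 3 :* p :+ p) refl

  -- The inductive step of the 3/4 bound at a coordinate with coefficient 0: `c` and `c′` are the
  -- counts on the two faces, each within 3/4 of `p`.
  double : ∀ {c c′} p → 4 ℕ.* c ≤ 3 ℕ.* p → c′ ≤ c → 4 ℕ.* (c ℕ.+ c′) ≤ 3 ℕ.* (2 ℕ.* p)
  double {c} {c′} p 4c≤3p c′≤c = begin
    4 ℕ.* (c ℕ.+ c′)      ≡⟨ ℕ.*-distribˡ-+ 4 c c′ ⟩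
    4 ℕ.* c ℕ.+ 4 ℕ.* c′  ≤⟨ ℕ.+-mono-≤ 4c≤3p (ℕ.≤-trans (ℕ.*-monoʳ-≤ 4 c′≤c) 4c≤3p) ⟩
    3 ℕ.* p ℕ.+ 3 ℕ.* p   ≡⟨ 3*p+3*p p ⟩
    3 ℕ.* (2 ℕ.* p)       ∎
    where open ℕ.≤-Reasoning

-- Reciprocals of rationals and invertible reals.

open ℚSolver

-- Totalised by inv 0 = 0.
inv : ℚ → ℚ
inv p with p ℚ.≟ 0ℚ
... | yes _  = 0ℚ
... | no p≢0 = (ℚ.1/ p) {{ℚ.≢-nonZero p≢0}}

inv-inverseʳ : ∀ {p} → p ≢ 0ℚ → p ℚ.* inv p ≡ 1ℚ
inv-inverseʳ {p} p≢0 with p ℚ.≟ 0ℚ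
... | yes p≡0 = contradiction p≡0 p≢0
... | no  p≢0 = ℚ.*-inverseʳ p {{ℚ.≢-nonZero p≢0}}

∣p∣>0⇒p≢0 : ∀ {p} → 0ℚ ℚ.< ∣ p ∣ → p ≢ 0ℚ
∣p∣>0⇒p≢0 0<∣p∣ refl = ℚ.<-irrefl refl 0<∣p∣

-- Multiplying the difference of the reciprocals by `p * q` turns it into `q - p`, and `δ * δ`
-- bounds the absolute value of that factor from below.
inv-close : ∀ {δ ε p q} → 0ℚ ℚ.< δ → δ ℚ.≤ ∣ p ∣ → δ ℚ.≤ ∣ q ∣ →
  ∣ q ℚ.- p ∣ ℚ.< ε ℚ.* (δ ℚ.* δ) → ∣ inv p ℚ.- inv q ∣ ℚ.< ε
inv-close {δ} {ε} {p} {q} 0<δ δ≤p δ≤q q-p< =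
  ℚ.*-cancelʳ-<-nonNeg (δ ℚ.* δ) {{δδ≥0}} (begin-strict
    ∣ inv p ℚ.- inv q ∣ ℚ.* (δ ℚ.* δ)
      ≤⟨ ℚ.*-monoˡ-≤-nonNeg ∣ inv p ℚ.- inv q ∣ {{ℚ.∣-∣-nonNeg (inv p ℚ.- inv q)}} δδ≤pq ⟩
    ∣ inv p ℚ.- inv q ∣ ℚ.* ∣ p ℚ.* q ∣
      ≡⟨ ℚ.∣p*q∣≡∣p∣*∣q∣ (inv p ℚ.- inv q) (p ℚ.* q) ⟨
    ∣ (inv p ℚ.- inv q) ℚ.* (p ℚ.* q) ∣
      ≡⟨ cong ∣_∣ (solve 4 (λ p q i j → (i :- j) :* (p :* q) := q :* (p :* i) :- p :* (q :* j))
           refl p q (inv p) (inv q)) ⟩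
    ∣ q ℚ.* (p ℚ.* inv p) ℚ.- p ℚ.* (q ℚ.* inv q) ∣
      ≡⟨ cong ∣_∣ (cong₂ (λ a b → q ℚ.* a ℚ.- p ℚ.* b) (inv-inverseʳ p≢0) (inv-inverseʳ q≢0)) ⟩
    ∣ q ℚ.* 1ℚ ℚ.- p ℚ.* 1ℚ ∣
      ≡⟨ cong ∣_∣ (cong₂ ℚ._-_ (ℚ.*-identityʳ q) (ℚ.*-identityʳ p)) ⟩
    ∣ q ℚ.- p ∣
      <⟨ q-p< ⟩
    ε ℚ.* (δ ℚ.* δ) ∎)
  where
  open ℚ.≤-Reasoning
  p≢0 = ∣p∣>0⇒p≢0 (ℚ.<-≤-trans 0<δ δ≤p)
  q≢0 = ∣p∣>0⇒p≢0 (ℚ.<-≤-trans 0<δ δ≤q)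
  instance
    δ≥0 : ℚ.NonNegative δ
    δ≥0 = ℚ.pos⇒nonNeg δ {{ℚ.positive 0<δ}}
  δδ≥0 : ℚ.NonNegative (δ ℚ.* δ)
  δδ≥0 = ℚ.nonNeg*nonNeg⇒nonNeg δ δ
  δδ≤pq : δ ℚ.* δ ℚ.≤ ∣ p ℚ.* q ∣
  δδ≤pq = begin
    δ ℚ.* δ         ≤⟨ ℚ.*-monoˡ-≤-nonNeg δ δ≤q ⟩
    δ ℚ.* ∣ q ∣     ≤⟨ ℚ.*-monoʳ-≤-nonNeg ∣ q ∣ {{ℚ.∣-∣-nonNeg q}} δ≤p ⟩
    ∣ p ∣ ℚ.* ∣ q ∣ ≡⟨ ℚ.∣p*q∣≡∣p∣*∣q∣ p q ⟨
    ∣ p ℚ.* q ∣     ∎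

-- Stands in for being nonzero: it carries an inverse to divide by, which `¬ x ≈ 0ℝ` does not.
Invertible : ℝ → Set
Invertible x = ∃[ y ] x * y ≈ 1ℝ

p-0≡p : ∀ p → p ℚ.- 0ℚ ≡ p
p-0≡p = solve 1 (λ p → p :- con 0ℚ := p) refl

∣p-p∣<ε : ∀ {p q ε} → p ≡ q → 0ℚ ℚ.< ε → ∣ p ℚ.- q ∣ ℚ.< ε
∣p-p∣<ε {p} {ε = ε} refl = subst (λ z → ∣ z ∣ ℚ.< ε) (sym (ℚ.+-inverseʳ p))

-- The sequence of reciprocals may contain the default value 0 before `N`. From `N` on every term is
-- a true reciprocal, and both the Cauchy condition and `_≈_` test only tails.
awayFrom0⇒Invertible : ∀ x {δ N} → 0ℚ ℚ.< δ → (∀ n → N ℕ.≤ n → δ ℚ.≤ ∣ seq x n ∣) → Invertible x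
awayFrom0⇒Invertible (mkℝ s cs) {δ} {N} 0<δ δ≤ = mkℝ (λ n → inv (s n)) isCauchy
  , mk≈ λ ε 0<ε → N , λ n N≤n →
      ∣p-p∣<ε (inv-inverseʳ (∣p∣>0⇒p≢0 (ℚ.<-≤-trans 0<δ (δ≤ n N≤n)))) 0<ε
  where
  isCauchy : IsCauchy (λ n → inv (s n))
  isCauchy ε 0<ε =
    let 0<εδδ = ℚ.positive⁻¹ (ε ℚ.* (δ ℚ.* δ))
          {{ℚ.pos*pos⇒pos ε {{ℚ.positive 0<ε}} (δ ℚ.* δ)
            {{ℚ.pos*pos⇒pos δ {{ℚ.positive 0<δ}} δ {{ℚ.positive 0<δ}}}}}}
        M , c = cs (ε ℚ.* (δ ℚ.* δ)) 0<εδδ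
    in  N ℕ.⊔ M , λ m n m≥ n≥ →
        inv-close 0<δ (δ≤ m (ℕ.m⊔n≤o⇒m≤o N M m≥)) (δ≤ n (ℕ.m⊔n≤o⇒m≤o N M n≥))
          (c n m (ℕ.m⊔n≤o⇒n≤o N M n≥) (ℕ.m⊔n≤o⇒n≤o N M m≥))

-- If |xₙ| ≥ ε for a single n past which the tail oscillates by less than ε/2,
-- then x stays at distance ε/2 from 0.
¬Invertible⇒≈0 : ∀ {x} → ¬ Invertible x → x ≈ 0ℝ
¬Invertible⇒≈0 {x} ¬inv = mk≈ λ ε 0<ε →
  let 0<δ = ℚ.positive⁻¹ (½ ℚ.* ε) {{ℚ.pos*pos⇒pos ½ ε {{ℚ.positive 0<ε}}}}
      N , c = cauchy x (½ ℚ.* ε) 0<δ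
      δ = ½ ℚ.* ε
  in  N , λ n N≤n → subst (ℚ._< ε) (cong ∣_∣ (sym (p-0≡p (seq x n))))
        (ℚ.≰⇒> λ ε≤∣xₙ∣ → ¬inv (awayFrom0⇒Invertible x 0<δ λ m N≤m →
          far {ε} ε≤∣xₙ∣ (c n m N≤n N≤m)))
  where
  open ℚ.≤-Reasoning
  far : ∀ {ε p q} → ε ℚ.≤ ∣ p ∣ → ∣ p ℚ.- q ∣ ℚ.< ½ ℚ.* ε → ½ ℚ.* ε ℚ.≤ ∣ q ∣
  far {ε} {p} {q} ε≤∣p∣ d< = ℚ.≮⇒≥ λ ∣q∣< → ℚ.<-irrefl refl (begin-strict
    ε                               ≤⟨ ε≤∣p∣ ⟩
    ∣ p ∣                           ≡⟨ cong ∣_∣ (solve 2 (λ p q → p := (p :- q) :+ q) refl p q) ⟩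
    ∣ (p ℚ.- q) ℚ.+ q ∣             ≤⟨ ℚ.∣p+q∣≤∣p∣+∣q∣ (p ℚ.- q) q ⟩
    ∣ p ℚ.- q ∣ ℚ.+ ∣ q ∣           <⟨ ℚ.+-mono-< d< ∣q∣< ⟩
    ½ ℚ.* ε ℚ.+ ½ ℚ.* ε             ≡⟨ solve 1 (λ e → con ½ :* e :+ con ½ :* e := e) refl ε ⟩
    ε                               ∎)

-- If p and q differed, their distance could itself serve as the tolerance, and would then be
-- smaller than itself.
fromℚ-injective : ∀ {p q} → fromℚ p ≈ fromℚ q → p ≡ q
fromℚ-injective {p} {q} p≈q with p ℚ.≟ q
... | yes p≡q = p≡q
... | no  p≢q = contradiction refl (ℚ.<⇒≢ (proj₂ (close p≈q ∣ p ℚ.- q ∣ 0<∣p-q∣) _ ℕ.≤-refl))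
  where
  0<∣p-q∣ : 0ℚ ℚ.< ∣ p ℚ.- q ∣
  0<∣p-q∣ = ℚ.≰⇒> λ ∣p-q∣≤0 → p≢q (trans
    (solve 2 (λ p q → p := (p :- q) :+ q) refl p q)
    (trans (cong (ℚ._+ q) (ℚ.∣p∣≡0⇒p≡0 _ (ℚ.≤-antisym ∣p-q∣≤0 (ℚ.0≤∣p∣ _)))) (ℚ.+-identityˡ q)))

-- Counting and enumerating Boolean vectors.

count : ∀ {k} {P : Pred (Vec Bool k) 0ℓ} → Decidable P → ℕ
count {zero}  P? = if does (P? []) then 1 else 0
count {suc k} P? = count (P? ∘ (false ∷_)) ℕ.+ count (P? ∘ (true ∷_))

count-mono : ∀ {k} {P Q : Pred (Vec Bool k) 0ℓ} (P? : Decidable P) (Q? : Decidable Q) →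
             (∀ y → P y → Q y) → count P? ≤ count Q?
count-mono {zero}  P? Q? P⇒Q with P? [] | Q? []
... | yes p | yes _ = ℕ.≤-refl
... | yes p | no ¬q = contradiction (P⇒Q [] p) ¬q
... | no _  | _     = z≤n
count-mono {suc k} P? Q? P⇒Q = ℕ.+-mono-≤
  (count-mono (P? ∘ (false ∷_)) (Q? ∘ (false ∷_)) (P⇒Q ∘ (false ∷_)))
  (count-mono (P? ∘ (true ∷_)) (Q? ∘ (true ∷_)) (P⇒Q ∘ (true ∷_)))

count-universal : ∀ {k} {P : Pred (Vec Bool k) 0ℓ} (P? : Decidable P) →
                  (∀ y → P y) → count P? ≡ 2 ^ k
count-universal {zero}  P? all with P? []
... | yes _ = refl
... | no ¬p = contradiction (all []) ¬p
count-universal {suc k} P? all = cong₂ ℕ._+_ (count-universal (P? ∘ (false ∷_)) (all ∘ (false ∷_)))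
  (trans (count-universal (P? ∘ (true ∷_)) (all ∘ (true ∷_))) (sym (ℕ.+-identityʳ (2 ^ k))))

count-empty : ∀ {k} {P : Pred (Vec Bool k) 0ℓ} (P? : Decidable P) →
              (∀ y → ¬ P y) → count P? ≡ 0
count-empty {zero}  P? none with P? []
... | yes p = contradiction p (none [])
... | no _  = refl
count-empty {suc k} P? none = cong₂ ℕ._+_ (count-empty (P? ∘ (false ∷_)) (none ∘ (false ∷_)))
  (count-empty (P? ∘ (true ∷_)) (none ∘ (true ∷_)))

-- Enumerates the solutions in lexicographic order. With the next two lemmas it matches
-- `Fin (count P?)` with the solutions, whose proofs of `P` are ignored in the comparison.
nth : ∀ {k} {P : Pred (Vec Bool k) 0ℓ} (P? : Decidable P) → Fin (count P?) → ∃[ y ] P y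
nth {zero}  P? i with P? []
... | yes p = [] , p
nth {suc k} P? i =
  [ map (false ∷_) id ∘ nth (P? ∘ (false ∷_))
  , map (true ∷_) id ∘ nth (P? ∘ (true ∷_))
  ]′ (splitAt (count (P? ∘ (false ∷_))) i)

nth-injective : ∀ {k} {P : Pred (Vec Bool k) 0ℓ} (P? : Decidable P) {i j} →
                proj₁ (nth P? i) ≡ proj₁ (nth P? j) → i ≡ j
nth-injective {zero}  P? {i} {j} _ with P? []
nth-injective {zero}  P? {zero} {zero} _ | yes p = refl
nth-injective {suc k} P? {i} {j} eq
  with splitAt (count (P? ∘ (false ∷_))) i in eqᵢ | splitAt (count (P? ∘ (false ∷_))) j in eqⱼ
... | inj₁ i′ | inj₁ j′ = trans (sym (Fin.splitAt⁻¹-↑ˡ eqᵢ))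
  (trans (cong (_↑ˡ _) (nth-injective (P? ∘ (false ∷_)) (Vec.∷-injectiveʳ eq))) (Fin.splitAt⁻¹-↑ˡ eqⱼ))
... | inj₁ i′ | inj₂ j′ = contradiction (Vec.∷-injectiveˡ eq) (λ ())
... | inj₂ i′ | inj₁ j′ = contradiction (Vec.∷-injectiveˡ eq) (λ ())
... | inj₂ i′ | inj₂ j′ = trans (sym (Fin.splitAt⁻¹-↑ʳ eqᵢ))
  (trans (cong (_ ↑ʳ_) (nth-injective (P? ∘ (true ∷_)) (Vec.∷-injectiveʳ eq))) (Fin.splitAt⁻¹-↑ʳ eqⱼ))

nth-surjective : ∀ {k} {P : Pred (Vec Bool k) 0ℓ} (P? : Decidable P) {y} → P y →
                 ∃[ i ] proj₁ (nth P? i) ≡ y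
nth-surjective {zero}  P? {[]} p with P? []
... | yes _ = zero , refl
... | no ¬p = contradiction p ¬p
nth-surjective {suc k} P? {false ∷ y} p =
  let i , eq = nth-surjective (P? ∘ (false ∷_)) p
      m = count (P? ∘ (false ∷_)); n = count (P? ∘ (true ∷_))
  in  i ↑ˡ n , trans (cong (proj₁ ∘ [ _ , _ ]′) (Fin.splitAt-↑ˡ m i n)) (cong (false ∷_) eq)
nth-surjective {suc k} P? {true ∷ y} p =
  let i , eq = nth-surjective (P? ∘ (true ∷_)) p
      m = count (P? ∘ (false ∷_)); n = count (P? ∘ (true ∷_))
  in  m ↑ʳ i , trans (cong (proj₁ ∘ [ _ , _ ]′) (Fin.splitAt-↑ʳ m n i)) (cong (true ∷_) eq)

-- Affine functions on the cube and the bound 3/4.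

IsBit : Pred ℝ 0ℓ
IsBit x = x ≈ 0ℝ ⊎ x ≈ 1ℝ

IsBit-resp-≈ : ∀ {x y} → x ≈ y → IsBit x → IsBit y
IsBit-resp-≈ x≈y (inj₁ x≈0) = inj₁ (R.trans (R.sym x≈y) x≈0)
IsBit-resp-≈ x≈y (inj₂ x≈1) = inj₂ (R.trans (R.sym x≈y) x≈1)

-- With the constant as an accumulator, the restriction to either face `false ∷ _` or `true ∷ _` is
-- by definition again of this form with coefficients `tail a`. This matches the way `count` splits,
-- so the bounds go by induction on the face.
affine : ∀ {k} → ℝ → ℝ^ k → Vec Bool k → ℝ
affine v a []          = v
affine v a (false ∷ y) = affine v (tail a) y
affine v a (true  ∷ y) = affine (v + head a) (tail a) y

affine-cong : ∀ {k v w} (a : ℝ^ k) y → v ≈ w → affine v a y ≈ affine w a y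
affine-cong a []          v≈w = v≈w
affine-cong a (false ∷ y) v≈w = affine-cong (tail a) y v≈w
affine-cong a (true  ∷ y) v≈w = affine-cong (tail a) y (R.+-congʳ v≈w)

BitAt : ∀ {k} → ℝ → ℝ^ k → Pred (Vec Bool k) 0ℓ
BitAt v a y = IsBit (affine v a y)

-- The values at the corners of a square whose two directions have nonzero coefficients; `v` and `z`
-- are opposite.
record Parallelogram (v w x z : ℝ) : Set where
  field
    v≉w      : ¬ v ≈ w
    v≉x      : ¬ v ≈ x
    diagonal : v + z ≈ w + x

+-cancelʳ : ∀ h {v w} → v + h ≈ w + h → v ≈ w
+-cancelʳ h {v} {w} = GroupProperties.∙-cancelʳ R.+-group h v w

-- Passing to the face `true ∷ _` adds the same coefficient to all four constants; the induction in
-- `parallelogram-count` needs this invariance.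
translate : ∀ h {v w x z} → Parallelogram v w x z → Parallelogram (v + h) (w + h) (x + h) (z + h)
translate h {v} {w} {x} {z} p = record
  { v≉w      = P.v≉w ∘ +-cancelʳ h
  ; v≉x      = P.v≉x ∘ +-cancelʳ h
  ; diagonal = R.trans (regroup v z) (R.trans (R.+-congʳ P.diagonal) (R.sym (regroup w x)))
  }
  where
  module P = Parallelogram p
  regroup : ∀ a b → (a + h) + (b + h) ≈ (a + b) + (h + h)
  regroup a b = pointwise⇒≈ λ n →
    solve 3 (λ a b h → (a :+ h) :+ (b :+ h) := (a :+ b) :+ (h :+ h)) refl (seq a n) (seq b n) (seq h n)

fromℚ-homo-+ : ∀ p q → fromℚ (p ℚ.+ q) ≈ fromℚ p + fromℚ q
fromℚ-homo-+ p q = pointwise⇒≈ λ _ → refl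

-- Moves the diagonal equation to ℚ, where a wrong equation between numerals is refuted by
-- computation.
fromℚ-parallelogram : ∀ {v w x z a b c d} → v ≈ fromℚ a → w ≈ fromℚ b → x ≈ fromℚ c → z ≈ fromℚ d →
                      v + z ≈ w + x → a ℚ.+ d ≡ b ℚ.+ c
fromℚ-parallelogram {v} {w} {x} {z} {a} {b} {c} {d} v≈a w≈b x≈c z≈d v+z≈w+x = fromℚ-injective (begin
  fromℚ (a ℚ.+ d)   ≈⟨ fromℚ-homo-+ a d ⟩
  fromℚ a + fromℚ d ≈⟨ +-cong v≈a z≈d ⟨
  v + z             ≈⟨ v+z≈w+x ⟩
  w + x             ≈⟨ +-cong w≈b x≈c ⟩
  fromℚ b + fromℚ c ≈⟨ fromℚ-homo-+ b c ⟨
  fromℚ (b ℚ.+ c)   ∎)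
  where open ≈-Reasoning

-- If `v` is a bit, then the bits `w` and `x`, being different from it, both equal 1 - v. So z = w +
-- x - v is 2 or -1.
¬allBits : ∀ {v w x z} → Parallelogram v w x z → IsBit v → IsBit w → IsBit x → ¬ IsBit z
¬allBits {v} {w} {x} {z} p = go
  where
  open Parallelogram p
  clash : ∀ a b c d → a ℚ.+ d ≢ b ℚ.+ c →
          v ≈ fromℚ a → w ≈ fromℚ b → x ≈ fromℚ c → ¬ z ≈ fromℚ d
  clash a b c d ≢ v≈a w≈b x≈c z≈d = ≢ (fromℚ-parallelogram v≈a w≈b x≈c z≈d diagonal)
  go : IsBit v → IsBit w → IsBit x → ¬ IsBit z
  go (inj₁ v≈0) (inj₁ w≈0) _ _ = v≉w (R.trans v≈0 (R.sym w≈0))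
  go (inj₁ v≈0) _ (inj₁ x≈0) _ = v≉x (R.trans v≈0 (R.sym x≈0))
  go (inj₂ v≈1) (inj₂ w≈1) _ _ = v≉w (R.trans v≈1 (R.sym w≈1))
  go (inj₂ v≈1) _ (inj₂ x≈1) _ = v≉x (R.trans v≈1 (R.sym x≈1))
  go (inj₁ v≈0) (inj₂ w≈1) (inj₂ x≈1) (inj₁ z≈0) = clash 0ℚ 1ℚ 1ℚ 0ℚ (λ ()) v≈0 w≈1 x≈1 z≈0
  go (inj₁ v≈0) (inj₂ w≈1) (inj₂ x≈1) (inj₂ z≈1) = clash 0ℚ 1ℚ 1ℚ 1ℚ (λ ()) v≈0 w≈1 x≈1 z≈1
  go (inj₂ v≈1) (inj₁ w≈0) (inj₁ x≈0) (inj₁ z≈0) = clash 1ℚ 0ℚ 0ℚ 0ℚ (λ ()) v≈1 w≈0 x≈0 z≈0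
  go (inj₂ v≈1) (inj₁ w≈0) (inj₁ x≈0) (inj₂ z≈1) = clash 1ℚ 0ℚ 0ℚ 1ℚ (λ ()) v≈1 w≈0 x≈0 z≈1

-- At every y the four values form a translate of the given parallelogram, so at most three of them
-- are bits; the bound is the sum over all y.
parallelogram-count : ∀ {k v w x z} (a : ℝ^ k) → Parallelogram v w x z →
  (V? : Decidable (BitAt v a)) (W? : Decidable (BitAt w a))
  (X? : Decidable (BitAt x a)) (Z? : Decidable (BitAt z a)) →
  (count V? ℕ.+ count W?) ℕ.+ (count X? ℕ.+ count Z?) ≤ 3 ℕ.* 2 ^ k
parallelogram-count {zero} a p V? W? X? Z? = go (V? []) (W? []) (X? []) (Z? [])
  where
  ind : ∀ {A : Set} → Dec A → ℕ
  ind A? = if does A? then 1 else 0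
  ind≤1 : ∀ {A} (A? : Dec A) → ind A? ≤ 1
  ind≤1 (yes _) = ℕ.≤-refl
  ind≤1 (no _)  = z≤n
  go : ∀ V? W? X? Z? → (ind V? ℕ.+ ind W?) ℕ.+ (ind X? ℕ.+ ind Z?) ≤ 3
  go (yes v) (yes w) (yes x) (yes z) = contradiction z (¬allBits p v w x)
  go (no _) W? X? Z? = ℕ.+-mono-≤ (ind≤1 W?) (ℕ.+-mono-≤ (ind≤1 X?) (ind≤1 Z?))
  -- `y` fixes how the bound 3 is shared between the two pairs of corners, and `u = 0` is the
  -- indicator of the failing corner.
  go V? (no _) X? Z? = ℕ.+-mono-≤ {y = 1} (ℕ.+-mono-≤ {u = 0} (ind≤1 V?) z≤n) (ℕ.+-mono-≤ (ind≤1 X?) (ind≤1 Z?))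
  go V? W? (no _) Z? = ℕ.+-mono-≤ {y = 2} (ℕ.+-mono-≤ (ind≤1 V?) (ind≤1 W?)) (ind≤1 Z?)
  go V? W? X? (no _) = ℕ.+-mono-≤ {y = 2} (ℕ.+-mono-≤ (ind≤1 V?) (ind≤1 W?)) (ℕ.+-mono-≤ {u = 0} (ind≤1 X?) z≤n)
parallelogram-count {suc k} a p V? W? X? Z? = begin
  ((vf ℕ.+ vt) ℕ.+ (wf ℕ.+ wt)) ℕ.+ ((xf ℕ.+ xt) ℕ.+ (zf ℕ.+ zt))
    ≡⟨ interchange₂ vf vt wf wt xf xt zf zt ⟩
  ((vf ℕ.+ wf) ℕ.+ (xf ℕ.+ zf)) ℕ.+ ((vt ℕ.+ wt) ℕ.+ (xt ℕ.+ zt))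
    ≤⟨ ℕ.+-mono-≤
         (parallelogram-count (tail a) p (V? ∘ (false ∷_)) (W? ∘ (false ∷_)) (X? ∘ (false ∷_)) (Z? ∘ (false ∷_)))
         (parallelogram-count (tail a) (translate (head a) p)
           (V? ∘ (true ∷_)) (W? ∘ (true ∷_)) (X? ∘ (true ∷_)) (Z? ∘ (true ∷_))) ⟩
  3 ℕ.* 2 ^ k ℕ.+ 3 ℕ.* 2 ^ k
    ≡⟨ 3*p+3*p (2 ^ k) ⟩
  3 ℕ.* 2 ^ suc k ∎
  where
  open ℕ.≤-Reasoning
  vf = count (V? ∘ (false ∷_)); vt = count (V? ∘ (true ∷_))
  wf = count (W? ∘ (false ∷_)); wt = count (W? ∘ (true ∷_))
  xf = count (X? ∘ (false ∷_)); xt = count (X? ∘ (true ∷_))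
  zf = count (Z? ∘ (false ∷_)); zt = count (Z? ∘ (true ∷_))

v≈v+0 : ∀ {v h} → h ≈ 0ℝ → v ≈ v + h
v≈v+0 {v} h≈0 = R.trans (R.sym (R.+-identityʳ v)) (R.+-congˡ (R.sym h≈0))

-- `v` and `w` are the constants on the two faces across a first direction with nonzero coefficient.
-- The search goes on for a second such direction: if there is one, the four constants form a
-- parallelogram; if there is none, both functions are constant.
pair-count : ∀ {k v w} (a : ℝ^ k) → (∀ j → Dec (a j ≈ 0ℝ)) → ¬ v ≈ w →
  (V? : Decidable (BitAt v a)) (W? : Decidable (BitAt w a)) →
  (∀ y → BitAt v a y × BitAt w a y) ⊎ 4 ℕ.* (count V? ℕ.+ count W?) ≤ 3 ℕ.* 2 ^ suc k
pair-count {zero}  a a≟0 v≉w V? W? with V? [] | W? []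
... | yes v | yes w = inj₁ λ { [] → v , w }
-- One bit among two values: 4 · 1 ≤ 3 · 2, with 6 written as 4 + 2.
... | yes _ | no _  = inj₂ (ℕ.m≤m+n 4 2)
... | no _  | yes _ = inj₂ (ℕ.m≤m+n 4 2)
... | no _  | no _  = inj₂ z≤n
pair-count {suc k} {v} {w} a a≟0 v≉w V? W? with a≟0 zero
... | yes h≈0 = [ inj₁ ∘ extend , inj₂ ∘ bound ]′
  (pair-count (tail a) (a≟0 ∘ suc) v≉w (V? ∘ (false ∷_)) (W? ∘ (false ∷_)))
  where
  extend : (∀ y → BitAt v (tail a) y × BitAt w (tail a) y) → ∀ y → BitAt v a y × BitAt w a y
  extend all (false ∷ y) = all y
  extend all (true  ∷ y) = map
    (IsBit-resp-≈ (affine-cong (tail a) y (v≈v+0 h≈0)))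
    (IsBit-resp-≈ (affine-cong (tail a) y (v≈v+0 h≈0))) (all y)
  shrink : ∀ v y → BitAt (v + head a) (tail a) y → BitAt v (tail a) y
  shrink v y = IsBit-resp-≈ (affine-cong (tail a) y (R.sym (v≈v+0 h≈0)))
  -- The coefficient here is 0, so the face `true ∷ _` counts no more solutions than the face
  -- `false ∷ _`.
  bound = λ le → subst (λ c → 4 ℕ.* c ≤ 3 ℕ.* 2 ^ suc (suc k))
    (interchange (count (V? ∘ (false ∷_))) (count (W? ∘ (false ∷_)))
                 (count (V? ∘ (true ∷_))) (count (W? ∘ (true ∷_))))
    (double (2 ^ suc k) le (ℕ.+-mono-≤
      (count-mono (V? ∘ (true ∷_)) (V? ∘ (false ∷_)) (shrink v))
      (count-mono (W? ∘ (true ∷_)) (W? ∘ (false ∷_)) (shrink w))))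
... | no h≉0 = inj₂ (begin
  4 ℕ.* ((vf ℕ.+ vt) ℕ.+ (wf ℕ.+ wt)) ≡⟨ cong (4 ℕ.*_) (interchange vf vt wf wt) ⟩
  4 ℕ.* ((vf ℕ.+ wf) ℕ.+ (vt ℕ.+ wt)) ≤⟨ ℕ.*-monoʳ-≤ 4 (parallelogram-count (tail a) parallelogram
    (V? ∘ (false ∷_)) (W? ∘ (false ∷_)) (V? ∘ (true ∷_)) (W? ∘ (true ∷_))) ⟩
  4 ℕ.* (3 ℕ.* 2 ^ k) ≡⟨ 4*3*p (2 ^ k) ⟩
  3 ℕ.* 2 ^ suc (suc k) ∎)
  where
  open ℕ.≤-Reasoning
  vf = count (V? ∘ (false ∷_)); vt = count (V? ∘ (true ∷_))
  wf = count (W? ∘ (false ∷_)); wt = count (W? ∘ (true ∷_))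
  h = head a
  parallelogram : Parallelogram v w (v + h) (w + h)
  parallelogram = record
    { v≉w = v≉w
    ; v≉x = λ v≈v+h → h≉0 (+-cancelʳ v (R.trans (R.+-comm h v) (R.trans (R.sym v≈v+h) (R.sym (R.+-identityˡ v)))))
    ; diagonal = pointwise⇒≈ λ n → solve 3
        (λ v w h → v :+ (w :+ h) := w :+ (v :+ h)) refl (seq v n) (seq w n) (seq h n)
    }

-- Searches for the first nonzero coefficient. Zero coefficients on the way repeat the same count on
-- both faces; at a nonzero one, `h`, the faces have the different constants `v` and `v + h`, and
-- `pair-count` takes over.
cube-count : ∀ {k v} (a : ℝ^ k) → (∀ j → Dec (a j ≈ 0ℝ)) → (V? : Decidable (BitAt v a)) →
  (∀ y → BitAt v a y) ⊎ 4 ℕ.* count V? ≤ 3 ℕ.* 2 ^ k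
cube-count {zero}  a a≟0 V? with V? []
... | yes v = inj₁ λ { [] → v }
... | no _  = inj₂ z≤n
cube-count {suc k} {v} a a≟0 V? with a≟0 zero
... | yes h≈0 = [ inj₁ ∘ extend , inj₂ ∘ bound ]′ (cube-count (tail a) (a≟0 ∘ suc) (V? ∘ (false ∷_)))
  where
  extend : (∀ y → BitAt v (tail a) y) → ∀ y → BitAt v a y
  extend all (false ∷ y) = all y
  extend all (true  ∷ y) = IsBit-resp-≈ (affine-cong (tail a) y (v≈v+0 h≈0)) (all y)
  bound = λ le → double (2 ^ k) le (count-mono (V? ∘ (true ∷_)) (V? ∘ (false ∷_))
    λ y → IsBit-resp-≈ (affine-cong (tail a) y (R.sym (v≈v+0 h≈0))))
... | no h≉0 = [ inj₁ ∘ extend , inj₂ ]′ (pair-count (tail a) (a≟0 ∘ suc) v≉v+h (V? ∘ (false ∷_)) (V? ∘ (true ∷_)))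
  where
  v≉v+h : ¬ v ≈ v + head a
  v≉v+h v≈v+h = h≉0 (+-cancelʳ v (R.trans (R.+-comm (head a) v) (R.trans (R.sym v≈v+h) (R.sym (R.+-identityˡ v)))))
  extend : (∀ y → BitAt v (tail a) y × BitAt (v + head a) (tail a) y) → ∀ y → BitAt v a y
  extend all (false ∷ y) = proj₁ (all y)
  extend all (true  ∷ y) = proj₂ (all y)

-- Dot products and their linearity.

dot : ∀ {k} → ℝ^ k → ℝ^ k → ℝ
dot c a = sum (λ j → c j * a j)

dot-cong : ∀ {k} {c c′ a a′ : ℝ^ k} → c ≋ c′ → a ≋ a′ → dot c a ≈ dot c′ a′
dot-cong {zero}  c≋c′ a≋a′ = R.refl
dot-cong {suc k} c≋c′ a≋a′ =
  +-cong (*-cong (c≋c′ zero) (a≋a′ zero)) (dot-cong (c≋c′ ∘ suc) (a≋a′ ∘ suc))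

dot-zeroˡ : ∀ {k} {c a : ℝ^ k} → c ≋ 0ᵥ → dot c a ≈ 0ℝ
dot-zeroˡ {zero}  c≋0 = R.refl
dot-zeroˡ {suc k} c≋0 = R.trans
  (+-cong (R.trans (*-cong (c≋0 zero) R.refl) (R.zeroˡ _)) (dot-zeroˡ (c≋0 ∘ suc))) (R.+-identityˡ _)

dot-comm : ∀ {k} (c a : ℝ^ k) → dot c a ≈ dot a c
dot-comm {zero}  c a = R.refl
dot-comm {suc k} c a = +-cong (R.*-comm _ _) (dot-comm (tail c) (tail a))

dot-zeroʳ : ∀ {k} {c a : ℝ^ k} → a ≋ 0ᵥ → dot c a ≈ 0ℝ
dot-zeroʳ {c = c} {a} a≋0 = R.trans (dot-comm c a) (dot-zeroˡ a≋0)

-- Linearity in the form of a row operation. It applies to linear combinations because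
-- `linearCombination c b i` is by definition `dot c (λ j → b j i)`.
dot-shearˡ : ∀ {k} s (c d a : ℝ^ k) → dot (c -ᵥ s *ᵥ d) a ≈ dot c a - s * dot d a
dot-shearˡ {zero}  s c d a = pointwise⇒≈ λ n → solve 1 (λ s → con 0ℚ := con 0ℚ :- s :* con 0ℚ) refl (seq s n)
dot-shearˡ {suc k} s c d a = R.trans (R.+-congˡ (dot-shearˡ s (tail c) (tail d) (tail a)))
  (pointwise⇒≈ λ n → solve 6 (λ s c d a C D → (c :- s :* d) :* a :+ (C :- s :* D) := (c :* a :+ C) :- s :* (d :* a :+ D))
    refl (seq s n) (seq (head c) n) (seq (head d) n) (seq (head a) n)
    (seq (dot (tail c) (tail a)) n) (seq (dot (tail d) (tail a)) n))

dot-shearʳ : ∀ {k} t (c a d : ℝ^ k) → dot c (λ j → a j - d j * t) ≈ dot c a - dot c d * t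
dot-shearʳ t c a d = begin
  dot c (λ j → a j - d j * t) ≈⟨ dot-cong (λ _ → R.refl) (λ j → R.+-congˡ (-‿cong (R.*-comm (d j) t))) ⟩
  dot c (a -ᵥ t *ᵥ d)         ≈⟨ dot-comm c (a -ᵥ t *ᵥ d) ⟩
  dot (a -ᵥ t *ᵥ d) c         ≈⟨ dot-shearˡ t a d c ⟩
  dot a c - t * dot d c       ≈⟨ +-cong (dot-comm a c) (-‿cong (*-cong R.refl (dot-comm d c))) ⟩
  dot c a - t * dot c d       ≈⟨ R.+-congˡ (-‿cong (R.*-comm t (dot c d))) ⟩
  dot c a - dot c d * t       ∎
  where open ≈-Reasoning

-- Gaussian elimination and reduced echelon form.

module _ {n} (V : LinearSubspace n) where
  open LinearSubspace V

  sub-closed : ∀ {v w} → Member v → Member w → Member (v -ᵥ w)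
  sub-closed {v} {w} v∈ w∈ = resp-≋
    (λ i → pointwise⇒≈ λ m → solve 2 (λ v w → v :+ (con (ℚ.- 1ℚ)) :* w := v :- w) refl (seq (v i) m) (seq (w i) m))
    (+-closed v∈ (*-closed (- 1ℝ) w∈))

  linearCombination-closed : ∀ {k} (c : ℝ^ k) {b : Vector (ℝ^ n) k} →
    (∀ j → Member (b j)) → Member (linearCombination c b)
  linearCombination-closed {zero}  c b∈ = 0-closed
  linearCombination-closed {suc k} c b∈ =
    +-closed (*-closed (c zero) (b∈ zero)) (linearCombination-closed (tail c) (b∈ ∘ suc))

  vanishingAt : Fin n → LinearSubspace n
  vanishingAt i = record
    { Member   = λ v → Member v × v i ≈ 0ℝ
    ; resp-≋   = λ u≋v (u∈ , uᵢ≈0) → resp-≋ u≋v u∈ , R.trans (R.sym (u≋v i)) uᵢ≈0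
    ; 0-closed = 0-closed , R.refl
    ; +-closed = λ (u∈ , uᵢ≈0) (v∈ , vᵢ≈0) → +-closed u∈ v∈ , R.trans (+-cong uᵢ≈0 vᵢ≈0) (R.+-identityˡ 0ℝ)
    ; *-closed = λ a (v∈ , vᵢ≈0) → *-closed a v∈ , R.trans (*-cong R.refl vᵢ≈0) (R.zeroʳ a)
    }

  reduce-∈ : ∀ {i u v} → Member u → u i ≈ 1ℝ → Member v →
             LinearSubspace.Member (vanishingAt i) (v -ᵥ v i *ᵥ u)
  reduce-∈ {i} {u} {v} u∈ uᵢ≈1 v∈ = sub-closed v∈ (*-closed (v i) u∈) , (begin
    v i - v i * u i ≈⟨ R.+-congˡ (-‿cong (*-cong R.refl uᵢ≈1)) ⟩
    v i - v i * 1ℝ  ≈⟨ R.+-congˡ (-‿cong (R.*-identityʳ (v i))) ⟩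
    v i - v i       ≈⟨ R.-‿inverseʳ (v i) ⟩
    0ℝ              ∎)
    where open ≈-Reasoning

  -- One elimination step: the first basis vector is scaled to `u` with entry 1 at `i`, and
  -- multiples of `u` are subtracted from the others to clear their entries at `i`.
  vanishingAt-dimension : ∀ {k i s} (dim : HasDimension V (suc k)) →
    HasDimension.basis dim zero i * s ≈ 1ℝ → HasDimension (vanishingAt i) k
  vanishingAt-dimension {k} {i} {s} dim b₀ᵢs≈1 = record
    { basis       = basis′
    ; basis∈V     = λ j → reduce-∈ (*-closed s (basis∈V zero)) uᵢ≈1 (basis∈V (suc j))
    ; independent = independent′
    ; spanning    = spanning′
    }
    where
    open HasDimension dim
    open ≈-Reasoning
    b₀ u : ℝ^ n
    b₀ = basis zero
    u = s *ᵥ b₀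
    uᵢ≈1 : u i ≈ 1ℝ
    uᵢ≈1 = R.trans (R.*-comm s (b₀ i)) b₀ᵢs≈1
    basis′ : Vector (ℝ^ n) k
    basis′ j = basis (suc j) -ᵥ basis (suc j) i *ᵥ u
    L : ℝ^ k → ℝ^ n
    L c = linearCombination c (tail basis)
    expand : ∀ c l → linearCombination c basis′ l ≈ L c l - L c i * u l
    expand c l = dot-shearʳ (u l) c (λ j → basis (suc j) l) (λ j → basis (suc j) i)
    independent′ : ∀ c → linearCombination c basis′ ≋ 0ᵥ → c ≋ 0ᵥ
    -- A relation among the reduced vectors is one among the old vectors; its coefficient at
    -- `basis zero` collects the subtracted multiples of `u`.
    independent′ c c·b′≋0 = independent ((- (L c i * s)) Vector.∷ c) (λ l → begin
      (- (L c i * s)) * b₀ l + L c l ≈⟨ pointwise⇒≈ (λ m →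
        solve 4 (λ T s b L → (:- (T :* s)) :* b :+ L := L :- T :* (s :* b)) refl
          (seq (L c i) m) (seq s m) (seq (b₀ l) m) (seq (L c l) m)) ⟩
      L c l - L c i * u l           ≈⟨ expand c l ⟨
      linearCombination c basis′ l  ≈⟨ c·b′≋0 l ⟩
      0ℝ                            ∎) ∘ suc
    spanning′ : ∀ {v} → Member v × v i ≈ 0ℝ → ∃[ c ] v ≋ linearCombination c basis′
    -- Rewriting the old expansion in `u` and the reduced vectors gives `u` the coefficient `v i`,
    -- which vanishes.
    spanning′ {v} (v∈ , vᵢ≈0) = tail c , λ l → begin
      v l                                              ≈⟨ v≋ l ⟩
      head c * b₀ l + L′ l                             ≈⟨ R.+-congʳ (*-cong (R.*-identityʳ (head c)) R.refl) ⟨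
      (head c * 1ℝ) * b₀ l + L′ l                      ≈⟨ R.+-congʳ (*-cong (*-cong R.refl b₀ᵢs≈1) R.refl) ⟨
      (head c * (b₀ i * s)) * b₀ l + L′ l              ≈⟨ pointwise⇒≈ (λ m →
        solve 6 (λ c b s d L T → (c :* (b :* s)) :* d :+ L := (c :* b :+ T) :* (s :* d) :+ (L :- T :* (s :* d))) refl
          (seq (head c) m) (seq (b₀ i) m) (seq s m) (seq (b₀ l) m) (seq (L′ l) m) (seq (L′ i) m)) ⟩
      (head c * b₀ i + L′ i) * u l + (L′ l - L′ i * u l) ≈⟨ R.+-congʳ (*-cong (R.trans (R.sym (v≋ i)) vᵢ≈0) R.refl) ⟩
      0ℝ * u l + (L′ l - L′ i * u l)                   ≈⟨ R.+-congʳ (R.zeroˡ (u l)) ⟩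
      0ℝ + (L′ l - L′ i * u l)                         ≈⟨ R.+-identityˡ _ ⟩
      L′ l - L′ i * u l                                ≈⟨ expand (tail c) l ⟨
      linearCombination (tail c) basis′ l              ∎
      where
      c = proj₁ (spanning v∈)
      v≋ = proj₂ (spanning v∈)
      L′ = L (tail c)

-- The frame restricts to the identity matrix at the pivots (`frame-pivot`), so a vector of `V` is
-- determined by its pivot coordinates, which are free.
record Echelon {n} (V : LinearSubspace n) (k : ℕ) : Set where
  open LinearSubspace V
  field
    pivot       : Fin k → Fin n
    frame       : Vector (ℝ^ n) k
    frame∈V     : ∀ j → Member (frame j)
    frame-pivot : ∀ c l → linearCombination c frame (pivot l) ≈ c l
    recover     : ∀ {v} → Member v → v ≋ linearCombination (v ∘ pivot) frame

1≉0 : ¬ 1ℝ ≈ 0ℝ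
1≉0 1≈0 with () ← fromℚ-injective {1ℚ} {0ℚ} 1≈0

-- A first basis vector without invertible coordinate would be zero, against independence with the
-- coefficients (1, 0, ..., 0).
¬¬-pivot : ∀ {n k} {V : LinearSubspace n} (dim : HasDimension V (suc k)) →
  ¬ ¬ (∃[ i ] Invertible (HasDimension.basis dim zero i))
¬¬-pivot {k = k} dim none = 1≉0 (independent (1ℝ Vector.∷ 0ᵥ) (λ l →
  R.trans (+-cong (R.trans (R.*-identityˡ _) (¬Invertible⇒≈0 (λ inv → none (l , inv))))
            (dot-zeroˡ {k} (λ _ → R.refl)))
          (R.+-identityˡ 0ℝ)) zero)
  where open HasDimension dim

extendEchelon : ∀ {n k i s} {V : LinearSubspace n} (dim : HasDimension V (suc k)) →
  HasDimension.basis dim zero i * s ≈ 1ℝ → Echelon (vanishingAt V i) k → Echelon V (suc k)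
extendEchelon {n} {k} {i} {s} {V} dim b₀ᵢs≈1 E′ = record
  { pivot       = pivot
  ; frame       = frame
  ; frame∈V     = frame∈V
  ; frame-pivot = frame-pivot
  ; recover     = recover
  }
  where
  open HasDimension dim
  open LinearSubspace V
  module E′ = Echelon E′
  open ≈-Reasoning
  u : ℝ^ n
  u = s *ᵥ basis zero
  u∈ : Member u
  u∈ = *-closed s (basis∈V zero)
  uᵢ≈1 : u i ≈ 1ℝ
  uᵢ≈1 = R.trans (R.*-comm s (basis zero i)) b₀ᵢs≈1
  project : ℝ^ n → ℝ^ n
  project v = linearCombination (v ∘ E′.pivot) E′.frame
  pivot : Fin (suc k) → Fin n
  pivot = i Vector.∷ E′.pivot
  e₀ : ℝ^ n
  -- `project u` agrees with `u` at the old pivots and vanishes at `i`, so `e₀` is 0 at the old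
  -- pivots and 1 at `i`. The old frame already vanishes at `i` and is kept.
  e₀ = u -ᵥ project u
  frame : Vector (ℝ^ n) (suc k)
  frame = e₀ Vector.∷ E′.frame
  vanish : ∀ c → linearCombination c E′.frame i ≈ 0ℝ
  vanish c = dot-zeroʳ {c = c} (λ j → proj₂ (E′.frame∈V j))
  frame∈V : ∀ j → Member (frame j)
  frame∈V zero    = sub-closed V u∈ (linearCombination-closed V (u ∘ E′.pivot) (proj₁ ∘ E′.frame∈V))
  frame∈V (suc j) = proj₁ (E′.frame∈V j)
  frame-pivot : ∀ c l → linearCombination c frame (pivot l) ≈ c l
  frame-pivot c zero = begin
    head c * (u i - project u i) + linearCombination (tail c) E′.frame i
      ≈⟨ +-cong (*-cong R.refl (+-cong uᵢ≈1 (-‿cong (vanish (u ∘ E′.pivot))))) (vanish (tail c)) ⟩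
    head c * (1ℝ - 0ℝ) + 0ℝ
      ≈⟨ pointwise⇒≈ (λ m → solve 1 (λ c → c :* (con 1ℚ :- con 0ℚ) :+ con 0ℚ := c) refl (seq (head c) m)) ⟩
    head c ∎
  frame-pivot c (suc l) = begin
    head c * (x - project u (E′.pivot l)) + linearCombination (tail c) E′.frame (E′.pivot l)
      ≈⟨ +-cong (*-cong R.refl (R.+-congˡ (-‿cong (E′.frame-pivot (u ∘ E′.pivot) l)))) (E′.frame-pivot (tail c) l) ⟩
    head c * (x - x) + c (suc l)
      ≈⟨ pointwise⇒≈ (λ m → solve 3 (λ c x d → c :* (x :- x) :+ d := d) refl (seq (head c) m) (seq x m) (seq (c (suc l)) m)) ⟩
    c (suc l) ∎
    where x = u (E′.pivot l)
  recover : ∀ {v} → Member v → v ≋ linearCombination (v ∘ pivot) frame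
  -- Subtracting `v i *ᵥ u` leads into `vanishingAt V i`, where the smaller echelon form recovers
  -- the vector; linearity of `project` then regroups the terms.
  recover {v} v∈ l = begin
    v l                                                ≈⟨ pointwise⇒≈ (λ m →
      solve 2 (λ v w → v := (v :- w) :+ w) refl (seq (v l) m) (seq (v i * u l) m)) ⟩
    (v l - v i * u l) + v i * u l                      ≈⟨ R.+-congʳ (E′.recover (reduce-∈ V u∈ uᵢ≈1 v∈) l) ⟩
    project (v -ᵥ v i *ᵥ u) l + v i * u l              ≈⟨ R.+-congʳ
      (dot-shearˡ (v i) (v ∘ E′.pivot) (u ∘ E′.pivot) (λ j → E′.frame j l)) ⟩
    (project v l - v i * project u l) + v i * u l      ≈⟨ pointwise⇒≈ (λ m →
      solve 4 (λ A s B u → (A :- s :* B) :+ s :* u := s :* (u :- B) :+ A) refl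
        (seq (project v l) m) (seq (v i) m) (seq (project u l) m) (seq (u l) m)) ⟩
    v i * (u l - project u l) + project v l            ∎

echelon : ∀ {n k} (V : LinearSubspace n) → HasDimension V k → ¬ ¬ Echelon V k
echelon {k = zero}  V dim ¬E = ¬E (record
  { pivot = λ () ; frame = λ () ; frame∈V = λ () ; frame-pivot = λ _ ()
  ; recover = λ v∈ → proj₂ (HasDimension.spanning dim v∈) })
echelon {k = suc k} V dim ¬E = ¬¬-pivot dim λ (i , s , b₀ᵢs≈1) →
  echelon (vanishingAt V i) (vanishingAt-dimension V dim b₀ᵢs≈1) (¬E ∘ extendEchelon dim b₀ᵢs≈1)

-- Uniqueness of cardinality, and Boolean vectors as points of the cube.

open ≈-Reasoning

-- Following one bijection by a section of the other gives an injection from `Fin t` to `Fin u`.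
HasCardinality-≤ : ∀ {n t u} {A : Pred (ℝ^ n) 0ℓ} → HasCardinality A t → HasCardinality A u → t ≤ u
HasCardinality-≤ {n} f g = Fin.injective⇒≤ {f = to⁻ ∘ F.to} λ {i} {j} eq →
  F.injective λ l → R.trans (R.sym (to∘to⁻ (F.to i) l))
    (R.trans (G.cong eq l) (to∘to⁻ (F.to j) l))
  where
  module F = Bijection f
  module G = Bijection g
  open G using (to⁻)
  to∘to⁻ : ∀ x → proj₁ (G.to (to⁻ x)) ≋ proj₁ x
  to∘to⁻ x = proj₂ (G.surjective x) refl

HasCardinality-unique : ∀ {n t u} {A : Pred (ℝ^ n) 0ℓ} → HasCardinality A t → HasCardinality A u → t ≡ u
HasCardinality-unique f g = ℕ.≤-antisym (HasCardinality-≤ f g) (HasCardinality-≤ g f)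

bit : Bool → ℝ
bit false = 0ℝ
bit true  = 1ℝ

bits : ∀ {k} → Vec Bool k → ℝ^ k
bits []      = λ ()
bits (b ∷ y) = bit b Vector.∷ bits y

IsBit-bits : ∀ {k} (y : Vec Bool k) j → IsBit (bits y j)
IsBit-bits (false ∷ y) zero    = inj₁ R.refl
IsBit-bits (true  ∷ y) zero    = inj₂ R.refl
IsBit-bits (b     ∷ y) (suc j) = IsBit-bits y j

bits-injective : ∀ {k} (y z : Vec Bool k) → bits y ≋ bits z → y ≡ z
bits-injective []          []          _  = refl
bits-injective (false ∷ y) (false ∷ z) eq = cong (false ∷_) (bits-injective y z (eq ∘ suc))
bits-injective (true  ∷ y) (true  ∷ z) eq = cong (true ∷_) (bits-injective y z (eq ∘ suc))
bits-injective (false ∷ y) (true  ∷ z) eq = contradiction (R.sym (eq zero)) 1≉0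
bits-injective (true  ∷ y) (false ∷ z) eq = contradiction (eq zero) 1≉0

bits-surjective : ∀ {k} {x : ℝ^ k} → Hypercube k x → ∃[ y ] bits y ≋ x
bits-surjective {zero}  x∈H = [] , λ ()
bits-surjective {suc k} x∈H with x∈H zero | bits-surjective (x∈H ∘ suc)
... | inj₁ x≈0 | y , eq = false ∷ y , λ { zero → R.sym x≈0 ; (suc j) → eq j }
... | inj₂ x≈1 | y , eq = true  ∷ y , λ { zero → R.sym x≈1 ; (suc j) → eq j }

affine-dot : ∀ {k} v (a : ℝ^ k) y → affine v a y ≈ v + dot (bits y) a
affine-dot v a []          = R.sym (R.+-identityʳ v)
affine-dot v a (false ∷ y) = R.trans (affine-dot v (tail a) y) (pointwise⇒≈ λ n →
  solve 3 (λ v h D → v :+ D := v :+ (con 0ℚ :* h :+ D)) refl (seq v n) (seq (head a) n) (seq (dot (bits y) (tail a)) n))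
affine-dot v a (true  ∷ y) = R.trans (affine-dot (v + head a) (tail a) y) (pointwise⇒≈ λ n →
  solve 3 (λ v h D → (v :+ h) :+ D := v :+ (con 1ℚ :* h :+ D)) refl (seq v n) (seq (head a) n) (seq (dot (bits y) (tail a)) n))

Hypercube-resp-≋ : ∀ {n} {x y : ℝ^ n} → x ≋ y → Hypercube n x → Hypercube n y
Hypercube-resp-≋ x≋y x∈H i = IsBit-resp-≈ (x≋y i) (x∈H i)

-- Cube points of an affine subspace in pivot coordinates.

module Chart {n k} (S : AffineSubspace n) (E : Echelon (AffineSubspace.direction S) k) where
  open AffineSubspace S
  open LinearSubspace direction
  open Echelon E

  -- The point of `S` with prescribed pivot coordinates `c`; subtracting those of `base` compensates
  -- for the translation.
  chart : ℝ^ k → ℝ^ n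
  chart c = base +ᵥ linearCombination (c -ᵥ base ∘ pivot) frame

  chart-cong : ∀ {c d} → c ≋ d → chart c ≋ chart d
  chart-cong {c} {d} c≋d i = R.+-congˡ (dot-cong (λ j → R.+-congʳ (c≋d j)) (λ _ → R.refl))

  chart-pivot : ∀ c l → chart c (pivot l) ≈ c l
  chart-pivot c l = R.trans (R.+-congˡ (frame-pivot (c -ᵥ base ∘ pivot) l)) (pointwise⇒≈ λ m →
    solve 2 (λ b c → b :+ (c :- b) := c) refl (seq (base (pivot l)) m) (seq (c l) m))

  chart∈S : ∀ c → Point (chart c)
  chart∈S c = resp-≋ (λ i → pointwise⇒≈ λ m →
      solve 2 (λ b x → x := (b :+ x) :- b) refl (seq (base i) m)
        (seq (linearCombination (c -ᵥ base ∘ pivot) frame i) m))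
    (linearCombination-closed direction (c -ᵥ base ∘ pivot) frame∈V)

  chart-recover : ∀ {x} → Point x → x ≋ chart (x ∘ pivot)
  chart-recover {x} x∈S i = R.trans
    (pointwise⇒≈ λ m → solve 2 (λ x b → x := b :+ (x :- b)) refl (seq (x i) m) (seq (base i) m))
    (R.+-congˡ (recover x∈S i))

  row : Fin n → ℝ^ k
  row i j = frame j i

  constant : Fin n → ℝ
  constant i = base i - linearCombination (base ∘ pivot) frame i

  chart-affine : ∀ y i → chart (bits y) i ≈ affine (constant i) (row i) y
  chart-affine y i = begin
    base i + dot (bits y -ᵥ β) (row i)         ≈⟨ R.+-congˡ (dot-cong (λ j → R.+-congˡ (-‿cong (R.*-identityˡ (β j)))) (λ _ → R.refl)) ⟨
    base i + dot (bits y -ᵥ 1ℝ *ᵥ β) (row i)   ≈⟨ R.+-congˡ (dot-shearˡ 1ℝ (bits y) β (row i)) ⟩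
    base i + (dot (bits y) (row i) - 1ℝ * dot β (row i)) ≈⟨ pointwise⇒≈ (λ m →
      solve 3 (λ b D B → b :+ (D :- con 1ℚ :* B) := (b :- B) :+ D) refl
        (seq (base i) m) (seq (dot (bits y) (row i)) m) (seq (dot β (row i)) m)) ⟩
    constant i + dot (bits y) (row i)          ≈⟨ affine-dot (constant i) (row i) y ⟨
    affine (constant i) (row i) y            ∎
    where
    β : ℝ^ k
    β = base ∘ pivot

  InCube : Pred (Vec Bool k) 0ℓ
  InCube y = Hypercube n (chart (bits y))

  BitAtRow : Fin n → Pred (Vec Bool k) 0ℓ
  BitAtRow i = BitAt (constant i) (row i)

  inCube⇒bitAtRow : ∀ i y → InCube y → BitAtRow i y
  inCube⇒bitAtRow i y y∈ = IsBit-resp-≈ {chart (bits y) i} {affine (constant i) (row i) y} (chart-affine y i) (y∈ i)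

  bitAtRow⇒inCube : ∀ y → (∀ i → BitAtRow i y) → InCube y
  bitAtRow⇒inCube y bit i = IsBit-resp-≈ {affine (constant i) (row i) y} (R.sym {chart (bits y) i} (chart-affine y i)) (bit i)

  -- The pivot coordinates of a cube point are bits, so the point is the chart of a Boolean vector;
  -- reading off those coordinates also makes the chart injective.
  hasCardinality : (C? : Decidable InCube) → HasCardinality (Hypercube n ∩ AffineSubspace.Point S) (count C?)
  hasCardinality C? = record
    { to        = to
    ; cong      = λ { {i} refl l → R.refl {proj₁ (to i) l} }
    ; bijective = (λ {i} {j} → injective {i} {j}) , surjective
    }
    where
    to : Fin (count C?) → ∃[ x ] x ∈ Hypercube n ∩ Point
    to i = chart (bits y) , y∈H , chart∈S (bits y)
      where
      y = proj₁ (nth C? i)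
      y∈H = proj₂ (nth C? i)
    injective : ∀ {i j} → proj₁ (to i) ≋ proj₁ (to j) → i ≡ j
    injective {i} {j} eq = nth-injective C? {i} {j} (bits-injective y z λ l → begin
      bits y l                 ≈⟨ chart-pivot (bits y) l ⟨
      chart (bits y) (pivot l) ≈⟨ eq (pivot l) ⟩
      chart (bits z) (pivot l) ≈⟨ chart-pivot (bits z) l ⟩
      bits z l                 ∎)
      where
      y z : Vec Bool k
      y = proj₁ (nth C? i)
      z = proj₁ (nth C? j)
    surjective : ∀ ((x , _) : ∃[ x ] x ∈ Hypercube n ∩ Point) → ∃[ i ] (∀ {j} → j ≡ i → proj₁ (to j) ≋ x)
    surjective (x , x∈H , x∈S) = i , λ { {j} j≡i l → R.trans {chart (bits (proj₁ (nth C? j))) l}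
        (R.reflexive (cong (λ z → chart (bits z) l) (trans (cong (proj₁ ∘ nth C?) j≡i) (proj₂ found)))) (chart≈x l) }
      where
      rounded : ∃[ y ] bits y ≋ x ∘ pivot
      rounded = bits-surjective (x∈H ∘ pivot)
      y : Vec Bool k
      y = proj₁ rounded
      chart≈x : chart (bits y) ≋ x
      chart≈x l = R.trans (chart-cong (proj₂ rounded) l) (R.sym (chart-recover x∈S l))
      found : ∃[ i ] proj₁ (nth C? i) ≡ y
      found = nth-surjective C? (Hypercube-resp-≋ (R.sym ∘ chart≈x) x∈H)
      i : Fin (count C?)
      i = proj₁ found

-- The gap between the two largest cardinalities.

¬¬-Π : ∀ {n} {P : Fin n → Set} → (∀ i → ¬ ¬ P i) → ¬ ¬ (∀ i → P i)
¬¬-Π = Fin.sequence (RawMonad.rawApplicative ¬¬-Monad)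

-- Only finitely many instances of excluded middle are involved. This makes `count` available, under
-- double negation, for predicates on reals.
¬¬-decidable : ∀ {k} (P : Pred (Vec Bool k) 0ℓ) → ¬ ¬ Decidable P
¬¬-decidable {zero}  P ¬P? = ¬¬-excluded-middle λ P? → ¬P? λ { [] → P? }
¬¬-decidable {suc k} P ¬P? =
  ¬¬-decidable (P ∘ (false ∷_)) λ F? → ¬¬-decidable (P ∘ (true ∷_)) λ T? →
  ¬P? λ { (false ∷ y) → F? y ; (true ∷ y) → T? y }

-- If both alternatives fail, no row can fail to be a bit somewhere, since that would give the 3/4
-- bound. Hence all rows are always bits and `t` is 2 ^ k after all.
chart-dichotomy : ∀ {n k t} (S : AffineSubspace n) (E : Echelon (AffineSubspace.direction S) k) →
  HasCardinality (Hypercube n ∩ AffineSubspace.Point S) t → ¬ ¬ (t ≡ 2 ^ k ⊎ 4 ℕ.* t ≤ 3 ℕ.* 2 ^ k)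
chart-dichotomy {n} {k} {t} S E card neither = ¬¬-decidable InCube onceDecided
  where
  open Chart S E
  onceDecided : ¬ Decidable InCube
  onceDecided C? = ¬¬-Π always λ all → neither (inj₁ (trans t≡count
    (count-universal C? λ y → bitAtRow⇒inCube y λ i → all i y)))
    where
    t≡count : t ≡ count C?
    t≡count = HasCardinality-unique {A = Hypercube n ∩ AffineSubspace.Point S} card (hasCardinality C?)
    always : ∀ i → ¬ ¬ (∀ y → BitAtRow i y)
    always i notAlways =
      ¬¬-Π (λ j → ¬¬-excluded-middle {A = row i j ≈ 0ℝ}) λ row≟0 →
      ¬¬-decidable (BitAtRow i) λ B? →
      [ notAlways
      -- The cube points are among the y at which row `i` alone is a bit.
      , (λ 4*count≤ → neither (inj₂ (ℕ.≤-trans (ℕ.*-monoʳ-≤ 4 (ℕ.≤-trans (ℕ.≤-reflexive t≡count)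
          (count-mono C? B? (inCube⇒bitAtRow i)))) 4*count≤)))
      ]′ (cube-count {v = constant i} (row i) row≟0 B?)

dichotomy : ∀ {n k t} (S : AffineSubspace n) → AffineDimension S k →
  HasCardinality (Hypercube n ∩ AffineSubspace.Point S) t → t ≡ 2 ^ k ⊎ 4 ℕ.* t ≤ 3 ℕ.* 2 ^ k
dichotomy {k = k} {t} S dim card =
  decidable-stable ((t ℕ.≟ 2 ^ k) ⊎-dec (4 ℕ.* t ℕ.≤? 3 ℕ.* 2 ^ k)) λ neither →
  echelon (AffineSubspace.direction S) dim λ E → chart-dichotomy S E card neither

-- Linear subspaces given by a matrix containing the identity.

δ : ∀ {k} → Fin k → ℝ^ k
δ zero    = 1ℝ Vector.∷ 0ᵥ
δ (suc j) = 0ℝ Vector.∷ δ j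

dot-δˡ : ∀ {k} j (a : ℝ^ k) → dot (δ j) a ≈ a j
dot-δˡ {suc k} zero    a = R.trans (+-cong (R.*-identityˡ _) (dot-zeroˡ {k} (λ _ → R.refl))) (R.+-identityʳ _)
dot-δˡ {suc k} (suc j) a = R.trans (+-cong (R.zeroˡ _) (dot-δˡ j (tail a))) (R.+-identityˡ _)

module Graph {n k} (row : Fin n → ℝ^ k) (pivot : Fin k → Fin n) (row-pivot : ∀ l → row (pivot l) ≋ δ l) where

  frame : Vector (ℝ^ n) k
  frame j i = row i j

  frame-pivot : ∀ c l → linearCombination c frame (pivot l) ≈ c l
  frame-pivot c l = begin
    dot c (row (pivot l)) ≈⟨ dot-cong (λ _ → R.refl) (row-pivot l) ⟩
    dot c (δ l)           ≈⟨ dot-comm c (δ l) ⟩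
    dot (δ l) c           ≈⟨ dot-δˡ l c ⟩
    c l                   ∎

  -- The column space of the matrix, described by an equation instead of an existential over
  -- coefficients: the coefficients can only be the pivot coordinates, and `recover` becomes the
  -- identity.
  Member : Pred (ℝ^ n) 0ℓ
  Member v = v ≋ linearCombination (v ∘ pivot) frame

  Member-resp-≋ : ∀ {u v} → u ≋ v → Member u → Member v
  Member-resp-≋ u≋v u∈ i = R.trans (R.sym (u≋v i))
    (R.trans (u∈ i) (dot-cong (u≋v ∘ pivot) (λ _ → R.refl)))

  linearCombination∈ : ∀ c → Member (linearCombination c frame)
  linearCombination∈ c i = dot-cong (R.sym ∘ frame-pivot c) (λ _ → R.refl)

  -- Gives both closure laws at once: addition with factor -1, scaling by subtracting from the zero
  -- vector.
  sub-scaled : ∀ a {u v} → Member u → Member v → Member (u -ᵥ a *ᵥ v)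
  sub-scaled a {u} {v} u∈ v∈ i = R.trans (+-cong (u∈ i) (-‿cong (*-cong R.refl (v∈ i))))
    (R.sym (dot-shearˡ a (u ∘ pivot) (v ∘ pivot) (row i)))

  0∈ : Member 0ᵥ
  0∈ i = R.sym (dot-zeroˡ {c = 0ᵥ} {row i} (λ _ → R.refl))

  V : LinearSubspace n
  V = record
    { Member   = Member
    ; resp-≋   = Member-resp-≋
    ; 0-closed = 0∈
    ; +-closed = λ {u} {v} u∈ v∈ → Member-resp-≋ (λ i → pointwise⇒≈ λ m →
        solve 2 (λ u v → u :- (con (ℚ.- 1ℚ)) :* v := u :+ v) refl (seq (u i) m) (seq (v i) m))
        (sub-scaled (- 1ℝ) u∈ v∈)
    ; *-closed = λ a {v} v∈ → Member-resp-≋ (λ i → pointwise⇒≈ λ m →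
        solve 2 (λ a v → con 0ℚ :- (:- a) :* v := a :* v) refl (seq a m) (seq (v i) m))
        (sub-scaled (- a) 0∈ v∈)
    }

  frame∈ : ∀ j → Member (frame j)
  frame∈ j = Member-resp-≋ (λ i → dot-δˡ j (row i)) (linearCombination∈ (δ j))

  S : AffineSubspace n
  S = record { base = 0ᵥ ; direction = V }

  dimension : AffineDimension S k
  dimension = record
    { basis       = frame
    ; basis∈V     = frame∈
    ; independent = λ c c≋0 l → R.trans (R.sym (frame-pivot c l)) (c≋0 (pivot l))
    ; spanning    = λ {v} v∈ → v ∘ pivot , v∈
    }

  echelonForm : Echelon V k
  echelonForm = record
    { pivot = pivot ; frame = frame ; frame∈V = frame∈ ; frame-pivot = frame-pivot ; recover = id }

  open Chart S echelonForm public hiding (row)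

  chart-dot : ∀ y i → chart (bits y) i ≈ dot (bits y) (row i)
  chart-dot y i = R.trans (R.+-identityˡ _)
    (dot-cong (λ j → pointwise⇒≈ λ m → solve 1 (λ x → x :- con 0ℚ := x) refl (seq (bits y j) m)) (λ _ → R.refl))

  cardinality∈H : (C? : Decidable (Chart.InCube S echelonForm)) → 0 < count C? → count C? ∈ H n k
  cardinality∈H C? 0<count = 0<count , S , dimension , Chart.hasCardinality S echelonForm C?

-- Subspaces attaining the two largest cardinalities.

dot-bits-δ : ∀ {k} (y : Vec Bool k) l → IsBit (dot (bits y) (δ l))
dot-bits-δ y l = IsBit-resp-≈ (R.sym (R.trans (dot-comm (bits y) (δ l)) (dot-δˡ l (bits y)))) (IsBit-bits y l)

-- The identity matrix with all coordinates as pivots gives the whole space, which contains every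
-- vertex of the cube.
2^k∈H : ∀ k → 2 ^ k ∈ H k k
2^k∈H k = subst (_∈ H k k) (count-universal C? inCube)
  (cardinality∈H C? (subst (0 <_) (sym (count-universal C? inCube)) (ℕ.m^n>0 2 k)))
  where
  open Graph {k} δ id (λ _ _ → R.refl)
  inCube : ∀ y → InCube y
  inCube y i = IsBit-resp-≈ (R.sym (chart-dot y i)) (dot-bits-δ y i)
  C? : Decidable InCube
  C? y = yes (inCube y)

affine-0ᵥ : ∀ {k} v (y : Vec Bool k) → affine v 0ᵥ y ≈ v
affine-0ᵥ v []          = R.refl
affine-0ᵥ v (false ∷ y) = affine-0ᵥ v y
affine-0ᵥ v (true  ∷ y) = R.trans (affine-0ᵥ (v + 0ℝ) y) (R.+-identityʳ v)

-- The first coordinate is y₁ + y₂, the next k + 2 are free, and the last r vanish.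
module SumCoordinate (k r : ℕ) where

  row : Fin (suc (suc (suc k)) ℕ.+ r) → ℝ^ (suc (suc k))
  row zero    = 1ℝ Vector.∷ 1ℝ Vector.∷ 0ᵥ
  row (suc i) = [ δ , const 0ᵥ ]′ (splitAt (suc (suc k)) i)

  row-pivot : ∀ l → row (suc (l ↑ˡ r)) ≋ δ l
  row-pivot l i rewrite Fin.splitAt-↑ˡ (suc (suc k)) l r = R.refl

  open Graph row (λ l → suc (l ↑ˡ r)) row-pivot

  IsBit-row : ∀ y i → IsBit (dot (bits y) (row (suc i)))
  IsBit-row y i with splitAt (suc (suc k)) i
  ... | inj₁ l = dot-bits-δ y l
  ... | inj₂ _ = inj₁ (dot-zeroʳ {c = bits y} (λ _ → R.refl))

  chart-zero : ∀ y → chart (bits y) zero ≈ affine 0ℝ (row zero) y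
  chart-zero y = R.trans (chart-dot y zero)
    (R.trans (R.sym (R.+-identityˡ _)) (R.sym (affine-dot 0ℝ (row zero) y)))

  inCube : ∀ y → IsBit (affine 0ℝ (row zero) y) → InCube y
  inCube y bit₀ zero    = IsBit-resp-≈ (R.sym (chart-zero y)) bit₀
  inCube y bit₀ (suc i) = IsBit-resp-≈ (R.sym (chart-dot y (suc i))) (IsBit-row y i)

  inCube-ff : ∀ y → InCube (false ∷ false ∷ y)
  inCube-ff y = inCube (false ∷ false ∷ y) (inj₁ (affine-0ᵥ 0ℝ y))

  inCube-ft : ∀ y → InCube (false ∷ true ∷ y)
  inCube-ft y = inCube (false ∷ true ∷ y) (inj₂ (R.trans (affine-0ᵥ (0ℝ + 1ℝ) y) (R.+-identityˡ 1ℝ)))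

  inCube-tf : ∀ y → InCube (true ∷ false ∷ y)
  inCube-tf y = inCube (true ∷ false ∷ y) (inj₂ (R.trans (affine-0ᵥ (0ℝ + 1ℝ) y) (R.+-identityˡ 1ℝ)))

  fromℚ-2 : fromℚ (0ℚ ℚ.+ 1ℚ ℚ.+ 1ℚ) ≈ 0ℝ + 1ℝ + 1ℝ
  fromℚ-2 = pointwise⇒≈ {fromℚ (0ℚ ℚ.+ 1ℚ ℚ.+ 1ℚ)} {0ℝ + 1ℝ + 1ℝ} λ _ → refl

  2≢0 : 0ℚ ℚ.+ 1ℚ ℚ.+ 1ℚ ≢ 0ℚ
  2≢0 ()

  2≢1 : 0ℚ ℚ.+ 1ℚ ℚ.+ 1ℚ ≢ 1ℚ
  2≢1 ()

  2≉bit : ¬ IsBit (0ℝ + 1ℝ + 1ℝ)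
  2≉bit (inj₁ 2≈0) = 2≢0 (fromℚ-injective (R.trans fromℚ-2 2≈0))
  2≉bit (inj₂ 2≈1) = 2≢1 (fromℚ-injective (R.trans fromℚ-2 2≈1))

  ¬inCube-tt : ∀ y → ¬ InCube (true ∷ true ∷ y)
  ¬inCube-tt y y∈ = 2≉bit (IsBit-resp-≈
    (R.trans (chart-zero (true ∷ true ∷ y)) (affine-0ᵥ (0ℝ + 1ℝ + 1ℝ) y)) (y∈ zero))

  C? : Decidable InCube
  C? (false ∷ false ∷ y) = yes (inCube-ff y)
  C? (false ∷ true  ∷ y) = yes (inCube-ft y)
  C? (true  ∷ false ∷ y) = yes (inCube-tf y)
  C? (true  ∷ true  ∷ y) = no (¬inCube-tt y)

  count≡ : count C? ≡ 3 ℕ.* 2 ^ k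
  count≡ = trans
    (cong₂ ℕ._+_
      (cong₂ ℕ._+_ (count-universal (C? ∘ (λ y → false ∷ false ∷ y)) inCube-ff)
                   (count-universal (C? ∘ (λ y → false ∷ true ∷ y)) inCube-ft))
      (cong₂ ℕ._+_ (count-universal (C? ∘ (λ y → true ∷ false ∷ y)) inCube-tf)
                   (count-empty (C? ∘ (λ y → true ∷ true ∷ y)) ¬inCube-tt)))
    -- The final 0 of the unfolded product `3 ℕ.* 2 ^ k` is the count of the empty face
    -- `true ∷ true ∷ _`, where the first coordinate is 2.
    (ℕ.+-assoc (2 ^ k) (2 ^ k) (2 ^ k ℕ.+ 0))

  3*2^k∈H : 3 ℕ.* 2 ^ k ∈ H (suc (suc (suc k)) ℕ.+ r) (suc (suc k))
  3*2^k∈H = subst (_∈ H (suc (suc (suc k)) ℕ.+ r) (suc (suc k))) count≡ (cardinality∈H C?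
    (subst (0 <_) (sym count≡) (ℕ.<-≤-trans (ℕ.m^n>0 2 k) (ℕ.m≤m+n (2 ^ k) _))))

-- The two largest elements of `H∞`, with dimension written as k + 2.

module _ (k : ℕ) where

  2^[k+2]∸2^k : 2 ^ suc (suc k) ∸ 2 ^ k ≡ 3 ℕ.* 2 ^ k
  2^[k+2]∸2^k = trans
    (cong (_∸ 2 ^ k) (4*p (2 ^ k)))
    (ℕ.m+n∸n≡m (3 ℕ.* 2 ^ k) (2 ^ k))

  -- Cancelling `2 ^ k` would leave 4 = 3.
  2^[k+2]≢3*2^k : 2 ^ suc (suc k) ≢ 3 ℕ.* 2 ^ k
  2^[k+2]≢3*2^k eq with () ← ℕ.*-cancelʳ-≡ 4 3 (2 ^ k) {{ℕ.m^n≢0 2 k}} (trans (ℕ.*-assoc 2 2 (2 ^ k)) eq)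

  H-dichotomy : ∀ {n t} → t ∈ H n (suc (suc k)) → t ≡ 2 ^ suc (suc k) ⊎ t ≤ 3 ℕ.* 2 ^ k
  H-dichotomy {t = t} (_ , S , dim , card) = map₂
    (λ 4t≤ → ℕ.*-cancelˡ-≤ 4 (subst (4 ℕ.* t ≤_) (sym (4*3*p (2 ^ k))) 4t≤))
    (dichotomy S dim card)

  3*2^k≤2^[k+2] : 3 ℕ.* 2 ^ k ≤ 2 ^ suc (suc k)
  3*2^k≤2^[k+2] = ℕ.≤-trans (ℕ.m≤m+n (3 ℕ.* 2 ^ k) (2 ^ k)) (ℕ.≤-reflexive (sym (4*p (2 ^ k))))

  H∞-largest : IsLargest (H∞ (suc (suc k))) (2 ^ suc (suc k))
  H∞-largest = (suc (suc k) , ℕ.≤-refl , 2^k∈H (suc (suc k)))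
    , λ t (_ , _ , t∈H) → [ ℕ.≤-reflexive , (λ t≤ → ℕ.≤-trans t≤ 3*2^k≤2^[k+2]) ]′ (H-dichotomy t∈H)

  3*2^k-attained : ∀ n → suc (suc k) < n → 3 ℕ.* 2 ^ k ∈ H n (suc (suc k))
  -- `n` is written as k + 3 + r, where r is the number of vanishing coordinates to append.
  3*2^k-attained n K<n = subst (λ n → 3 ℕ.* 2 ^ k ∈ H n (suc (suc k)))
    (proj₂ (ℕ.m≤n⇒∃[o]m+o≡n K<n)) (SumCoordinate.3*2^k∈H k (proj₁ (ℕ.m≤n⇒∃[o]m+o≡n K<n)))

  H∞-secondLargest : IsSecondLargest (H∞ (suc (suc k))) (3 ℕ.* 2 ^ k)
  H∞-secondLargest = 2 ^ suc (suc k) , H∞-largest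
    , ((suc (suc (suc k)) , ℕ.n≤1+n _ , 3*2^k-attained (suc (suc (suc k))) ℕ.≤-refl) , 2^[k+2]≢3*2^k)
    , λ t ((_ , _ , t∈H) , t≢) → [ (λ t≡ → contradiction (sym t≡) t≢) , id ]′ (H-dichotomy t∈H)

theorem3p1 : (k : ℕ) → 2 ≤ k →
    IsLargest (H∞ k) (2 ^ k) ×
    IsSecondLargest (H∞ k) (2 ^ k ∸ 2 ^ (k ∸ 2)) ×
    ((n : ℕ) → k < n → (2 ^ k ∸ 2 ^ (k ∸ 2)) ∈ H n k)
theorem3p1 (suc zero) (ℕ.s≤s ())
theorem3p1 (suc (suc k)) _ =
    H∞-largest k
  , subst (λ s → IsSecondLargest (H∞ (suc (suc k))) s × (∀ n → suc (suc k) < n → s ∈ H n (suc (suc k))))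
      (sym (2^[k+2]∸2^k k)) (H∞-secondLargest k , 3*2^k-attained k)
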